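{- Let $P$ be a $d$-polytope with the $V(P)$-pointed triangulation $\mathcal{C}_P$, and for $k\in\{0,1,\ldots,d\}$ let $d_k$ be the number of $k$-simplexes in $\mathcal{C}_P$. Then the $V(P)$-polytope numbers are represented by $$P(n)=\sum_{k=0}^{d}d_k\,\alpha^k\big(n-(k+1)\big).$$
   Context: A $d$-polytope is a $d$-dimensional convex hull of finitely many points in some $\mathbb{R}^e$. Pointed triangulation: let $\mathbf{c}\mathbf{x}$ be a linear function taking distinct values at distinct vertexes of $P$. For each nonempty face $F$ of $P$ (including $P$) let the apex $\mathbf{v}_F$ be the unique vertex of $F$ at which $\mathbf{c}\mathbf{x}$ attains its minimum on $F$; $V(P)$ denotes this system of apexes. The $V(P)$-pointed triangulation of $P$ is $$\mathcal{C}_P=\{\emptyset\}\cup\big\{conv(\{\mathbf{v}_{G_1},\ldots,\mathbf{v}_{G_k}\}) : 1\le k\le d+1,\ G_1\supsetneq\cdots\supsetneq G_k \text{ nonempty faces of } P,\ \mathbf{v}_{G_i}\notin G_{i+1}\ (1\le i<k)\big\},$$ which is a triangulation of $P$. Polytope numbers: let $\mathcal{F}(P)$ be the set of nonempty faces of $P$, including $P$. With the apexes above, the $V(P)$-polytope numbers $P(n)$ and interior polytope numbers $P(n)^\sharp$ are defined by double induction on $d=\dim P$ and $n\ge0$ (each face is a polytope with the inherited apexes): if $d=0$, $P(0)=P(0)^\sharp=0$ and $P(n)=P(n)^\sharp=1$ for $n\ge1$; if $d\ge1$, $P(0)=0$, $P(1)=1$, $P(0)^\sharp=P(1)^\sharp=0$,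 and for $n\ge2$ $$P(n)=P(n-1)+\sum_{F\in\mathcal{F}(P),\ \mathbf{v}_P\notin F}F(n)^\sharp,\qquad P(n)^\sharp=P(n)-\sum_{F\in\mathcal{F}(P)\setminus\{P\}}F(n)^\sharp .$$ $\alpha^k(m)$ denotes the polytope numbers of a $k$-simplex; explicitly $\alpha^k(m)=\binom{m+k-1}{k}$ for $m\ge1$ and $\alpha^k(m)=0$ for $m\le0$ (also for $k=0$).
   Formalization: The case n = 1 is excluded, since there P(1) = 1 while every α^k(1-(k+1)) is 0, so the identity fails for every polytope; coordinates lie in any ordered field with decidable order, of which the reals are classically an instance. -}

module Defs where

open import Algebra.Bundles using (CommutativeRing)
open import Algebra.Structures using (IsCommutativeRing)
open import Data.Bool as Bool using (Bool; true; false; _∨_)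
open import Data.Fin using (Fin; zero; suc; inject₁)
open import Data.Fin.Properties using (all?)
open import Data.Fin.Subset using (Subset; inside; outside; ⊤; ∣_∣; Nonempty; _∈_; _∉_; _⊆_; _⊂_)
open import Data.Fin.Subset.Properties using (_∈?_; _⊆?_; nonempty?)
open import Data.Integer using (ℤ; +_; -[1+_])
import Data.Integer as ℤ
open import Data.List using (List; []; _∷_; _++_; map; foldr; filter; concat; tabulate; cartesianProductWith)
open import Data.List.Membership.Propositional using () renaming (_∈_ to _∈ₗ_)
open import Data.List.Membership.Propositional.Properties using (∈-cartesianProductWith⁺; ∈-cartesianProductWith⁻)
open import Data.List.Relation.Unary.All as All using (All; []; _∷_)
open import Data.List.Relation.Unary.All.Properties using (++⁺; ++⁻ˡ; ++⁻ʳ; concat⁺; concat⁻; tabulate⁺; tabulate⁻)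
open import Data.List.Relation.Unary.Any using (here; there)
open import Data.Nat using (ℕ; zero; suc; _≤_; _∸_)
import Data.Nat as ℕ
open import Data.Nat.Combinatorics using (_C_)
open import Data.Product using (∃; ∃-syntax; Σ-syntax; _×_; _,_; proj₁; proj₂)
open import Data.Sum using (_⊎_; inj₁; inj₂)
open import Data.Vec using ([]; _∷_)
open import Data.Vec.Functional using (Vector; head; tail) renaming (_∷_ to _◂_)
open import Data.Vec.Properties using (≡-dec)
open import Function using (_∘_)
open import Level using (Level; _⊔_) renaming (suc to lsuc)
open import Relation.Binary using (Rel; IsDecTotalOrder)
open import Relation.Binary.PropositionalEquality as ≡ using (_≡_; _≢_)
open import Relation.Nullary using (¬_; Dec; yes; no; ¬?; contradiction)
open import Relation.Nullary.Decidable using (map′; _×-dec_; _→-dec_)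
open import Relation.Unary using (Pred; _≐_; ∅) renaming (_∈_ to _∈ₚ_)

-- Only the ordered-field structure of the coordinates is used. The real
-- numbers, whose order is total and decidable in classical logic, are one
-- instance; ℚ is another.
record OrderedField c ℓ₁ ℓ₂ : Set (lsuc (c ⊔ ℓ₁ ⊔ ℓ₂)) where
  infix  8 -_
  infixl 7 _*_
  infixl 6 _+_
  infix  4 _≈_ _≲_
  field
    Carrier           : Set c
    _≈_               : Rel Carrier ℓ₁
    _≲_               : Rel Carrier ℓ₂
    _+_ _*_           : Carrier → Carrier → Carrier
    -_                : Carrier → Carrier
    0# 1#             : Carrier
    isCommutativeRing : IsCommutativeRing _≈_ _+_ _*_ -_ 0# 1#
    isDecTotalOrder   : IsDecTotalOrder _≈_ _≲_
    +-monoˡ-≲         : ∀ z {x y} → x ≲ y → x + z ≲ y + z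
    *-nonNeg          : ∀ {x y} → 0# ≲ x → 0# ≲ y → 0# ≲ x * y
    0≉1               : ¬ 0# ≈ 1#
    inverse           : ∀ x → ¬ x ≈ 0# → ∃ λ y → x * y ≈ 1#

  commutativeRing : CommutativeRing c ℓ₁
  commutativeRing = record { isCommutativeRing = isCommutativeRing }

  open IsDecTotalOrder isDecTotalOrder public
    using (_≟_; module Eq)
    renaming (_≤?_ to _≲?_; total to ≲-total; antisym to ≲-antisym; trans to ≲-trans;
              reflexive to ≲-reflexive; refl to ≲-refl; ≤-respʳ-≈ to ≲-respʳ-≈; ≤-respˡ-≈ to ≲-respˡ-≈)

∑ : ∀ {a} {A : Set a} → List A → (A → ℤ) → ℤ
∑ xs f = foldr (λ x s → f x ℤ.+ s) (+ 0) xs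

allSubsets : ∀ m → List (Subset m)
allSubsets zero    = [] ∷ []
allSubsets (suc m) = map (outside ∷_) (allSubsets m) ++ map (inside ∷_) (allSubsets m)

-- The polytope numbers of the k-simplex, extended by 0 to m ≤ 0, also for k = 0.
α : ℕ → ℤ → ℕ
α k (+ zero)   = 0
α k (+ suc m)  = (suc m ℕ.+ k ∸ 1) C k
α k (-[1+ _ ]) = 0

module Polytopes {c ℓ₁ ℓ₂} (K : OrderedField c ℓ₁ ℓ₂) where

  open OrderedField K
  open CommutativeRing commutativeRing
    using (semiring; ring; +-commutativeMonoid; +-abelianGroup; setoid; +-cong; +-congˡ; +-congʳ; *-cong; *-congˡ; *-congʳ;
           -‿cong; -‿inverseˡ; -‿inverseʳ; +-identityʳ; +-identityˡ; +-assoc; +-comm;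
           *-identityˡ; *-assoc; *-comm; zeroˡ; zeroʳ; distribˡ; distribʳ; refl; sym; trans)
  open import Algebra.Properties.CommutativeMonoid.Sum +-commutativeMonoid
    using (sum; sum-cong-≋; sum-replicate-zero; ∑-comm; ∑-distrib-+)
  open import Algebra.Properties.Semiring.Sum semiring using (*-distribˡ-sum; *-distribʳ-sum)
  open import Algebra.Properties.Ring ring using (-‿distribˡ-*; -‿distribʳ-*; -‿+-comm; -‿involutive)
  open import Relation.Binary.Reasoning.Setoid setoid

  private
    ℓ : Level
    ℓ = c ⊔ ℓ₁ ⊔ ℓ₂

  Point : ℕ → Set c
  Point e = Vector Carrier e

  infix  4 _≋_
  infixl 7 _·_

  _≋_ : ∀ {e} → Rel (Point e) ℓ₁
  x ≋ y = ∀ j → x j ≈ y j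

  _·_ : ∀ {e} → Point e → Point e → Carrier
  a · x = sum (λ j → a j * x j)

  comb : ∀ {e m} → (Fin m → Carrier) → (Fin m → Point e) → Point e
  comb w q j = sum (λ i → w i * q i j)

  Sgn : Bool → Carrier → Set ℓ₂
  Sgn false x = 0# ≲ x
  Sgn true  x = ¬ x ≲ 0#

  sgn? : ∀ s x → Dec (Sgn s x)
  sgn? false x = 0# ≲? x
  sgn? true  x = ¬? (x ≲? 0#)

  sgn-resp : ∀ s {x y} → x ≈ y → Sgn s x → Sgn s y
  sgn-resp false x≈y p = ≲-respʳ-≈ x≈y p
  sgn-resp true  x≈y p = p ∘ ≲-respˡ-≈ (sym x≈y)

  sgn-weaken : ∀ s {x} → Sgn s x → 0# ≲ x
  sgn-weaken false p = p
  sgn-weaken true {x} p with ≲-total 0# x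
  ... | inj₁ q = q
  ... | inj₂ q = contradiction q p

  sgn-∨ : ∀ s t {x} → Sgn (s ∨ t) x → Sgn s x × Sgn t x
  sgn-∨ false t     p = sgn-weaken t p , p
  sgn-∨ true  false p = p , sgn-weaken true p
  sgn-∨ true  true  p = p , p

  +-monoʳ-≲ : ∀ z {x y} → x ≲ y → z + x ≲ z + y
  +-monoʳ-≲ z p = ≲-respʳ-≈ (+-comm _ z) (≲-respˡ-≈ (+-comm _ z) (+-monoˡ-≲ z p))

  sgn-+ : ∀ s t {x y} → Sgn s x → Sgn t y → Sgn (s ∨ t) (x + y)
  sgn-+ false false {x} {y} p q = ≲-trans p (≲-respˡ-≈ (+-identityʳ x) (+-monoʳ-≲ x q))
  sgn-+ true  t     {x} {y} p q r =
    p (≲-trans (≲-respˡ-≈ (+-identityʳ x) (+-monoʳ-≲ x (sgn-weaken t q))) r)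
  sgn-+ false true  {x} {y} p q r =
    q (≲-trans (≲-respˡ-≈ (+-identityˡ y) (+-monoˡ-≲ y p)) r)

  pos⇒≉0 : ∀ {x} → Sgn true x → ¬ x ≈ 0#
  pos⇒≉0 p x≈0 = p (≲-reflexive x≈0)

  *-cancel-≈0 : ∀ {x y} → ¬ x ≈ 0# → x * y ≈ 0# → y ≈ 0#
  *-cancel-≈0 {x} {y} x≉0 xy≈0 with inverse x x≉0
  ... | z , xz≈1 = begin
    y             ≈⟨ *-identityˡ y ⟨
    1# * y        ≈⟨ *-congʳ xz≈1 ⟨
    (x * z) * y   ≈⟨ *-congʳ (*-comm x z) ⟩
    (z * x) * y   ≈⟨ *-assoc z x y ⟩
    z * (x * y)   ≈⟨ *-congˡ xy≈0 ⟩
    z * 0#        ≈⟨ zeroʳ z ⟩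
    0#            ∎

  sgn-* : ∀ s {k x} → Sgn true k → Sgn s x → Sgn s (k * x)
  sgn-* false k>0 p = *-nonNeg (sgn-weaken true k>0) p
  sgn-* true  k>0 p r =
    pos⇒≉0 p (*-cancel-≈0 (pos⇒≉0 k>0)
      (≲-antisym r (*-nonNeg (sgn-weaken true k>0) (sgn-weaken true p))))

  neg-≲ : ∀ {x} → x ≲ 0# → 0# ≲ - x
  neg-≲ {x} p = ≲-respʳ-≈ (+-identityˡ _) (≲-respˡ-≈ (-‿inverseʳ x) (+-monoˡ-≲ (- x) p))

  neg-≲⁻ : ∀ {x} → 0# ≲ - x → x ≲ 0#
  neg-≲⁻ {x} p = ≲-respʳ-≈ (-‿inverseˡ x) (≲-respˡ-≈ (+-identityˡ x) (+-monoˡ-≲ x p))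

  0≲1 : 0# ≲ 1#
  0≲1 with ≲-total 0# 1#
  ... | inj₁ p = p
  ... | inj₂ p = ≲-respʳ-≈ eq (*-nonNeg (neg-≲ p) (neg-≲ p))
    where
    eq : - 1# * - 1# ≈ 1#
    eq = begin
      - 1# * - 1#     ≈⟨ -‿distribˡ-* 1# (- 1#) ⟨
      - (1# * - 1#)   ≈⟨ -‿cong (*-identityˡ _) ⟩
      - - 1#          ≈⟨ -‿involutive 1# ⟩
      1#              ∎

  1>0 : Sgn true 1#
  1>0 p = 0≉1 (≲-antisym 0≲1 p)

  pos-inverse : ∀ {x} → Sgn true x → ∃ λ k → Sgn true k × x * k ≈ 1#
  pos-inverse {x} x>0 with inverse x (pos⇒≉0 x>0)
  ... | k , xk≈1 = k , k>0 , xk≈1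
    where
    k>0 : Sgn true k
    k>0 k≲0 = 1>0 (neg-≲⁻ (≲-respʳ-≈ eq (*-nonNeg (sgn-weaken true x>0) (neg-≲ k≲0))))
      where
      eq : x * - k ≈ - 1#
      eq = trans (sym (-‿distribʳ-* x k)) (-‿cong xk≈1)

  diff⁺ : ∀ {x y} → x ≲ y → 0# ≲ y + - x
  diff⁺ {x} p = ≲-respˡ-≈ (-‿inverseʳ x) (+-monoˡ-≲ (- x) p)

  cancel-+- : ∀ x y → (y + - x) + x ≈ y
  cancel-+- x y = trans (+-assoc y (- x) x) (trans (+-congˡ (-‿inverseˡ x)) (+-identityʳ y))

  diff⁻ : ∀ {x y} → 0# ≲ y + - x → x ≲ y
  diff⁻ {x} {y} p = ≲-respʳ-≈ (cancel-+- x y) (≲-respˡ-≈ (+-identityˡ x) (+-monoˡ-≲ x p))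

  diff≈0 : ∀ {x y} → y + - x ≈ 0# → x ≈ y
  diff≈0 {x} {y} p = trans (sym (+-identityˡ x)) (trans (+-congʳ (sym p)) (cancel-+- x y))

  ≈⇒diff : ∀ {x y} → x ≈ y → y + - x ≈ 0#
  ≈⇒diff {x} p = trans (+-congʳ (sym p)) (-‿inverseʳ x)

  sum-cong : ∀ {n} {f g : Vector Carrier n} → (∀ i → f i ≈ g i) → sum f ≈ sum g
  sum-cong = sum-cong-≋

  sum-≈0 : ∀ {n} {f : Vector Carrier n} → (∀ i → f i ≈ 0#) → sum f ≈ 0#
  sum-≈0 {n} f≈0 = trans (sum-cong f≈0) (sum-replicate-zero n)

  sum-nonNeg : ∀ {n} {f : Vector Carrier n} → (∀ i → 0# ≲ f i) → 0# ≲ sum f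
  sum-nonNeg {zero}  p = ≲-refl
  sum-nonNeg {suc n} p = sgn-+ false false (p zero) (sum-nonNeg (p ∘ suc))

  nonNeg-+≈0 : ∀ {x y} → 0# ≲ x → 0# ≲ y → x + y ≈ 0# → x ≈ 0# × y ≈ 0#
  nonNeg-+≈0 {x} {y} p q r = x≈0 , trans (sym (+-identityˡ y)) (trans (+-congʳ (sym x≈0)) r)
    where
    x≈0 : x ≈ 0#
    x≈0 = ≲-antisym (≲-respʳ-≈ r (≲-respˡ-≈ (+-identityʳ x) (+-monoʳ-≲ x q))) p

  sum≈0⇒≈0 : ∀ {n} {f : Vector Carrier n} → (∀ i → 0# ≲ f i) → sum f ≈ 0# → ∀ i → f i ≈ 0#
  sum≈0⇒≈0 p r zero    = proj₁ (nonNeg-+≈0 (p zero) (sum-nonNeg (p ∘ suc)) r)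
  sum≈0⇒≈0 p r (suc i) = sum≈0⇒≈0 (p ∘ suc) (proj₂ (nonNeg-+≈0 (p zero) (sum-nonNeg (p ∘ suc)) r)) i

  sum-neg : ∀ {n} (f : Vector Carrier n) → sum (λ i → - f i) ≈ - sum f
  sum-neg {n} f = begin
    sum (λ i → - f i)         ≈⟨ sum-cong (λ i → trans (-‿cong (sym (*-identityˡ (f i)))) (-‿distribˡ-* 1# (f i))) ⟩
    sum (λ i → - 1# * f i)    ≈⟨ *-distribˡ-sum (- 1#) f ⟨
    - 1# * sum f              ≈⟨ -‿distribˡ-* 1# (sum f) ⟨
    - (1# * sum f)            ≈⟨ -‿cong (*-identityˡ _) ⟩
    - sum f                   ∎

  ·-+ : ∀ {e} (a b x : Point e) → (λ j → a j + b j) · x ≈ a · x + b · x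
  ·-+ a b x = trans (sum-cong (λ j → distribʳ (x j) (a j) (b j))) (∑-distrib-+ (λ j → a j * x j) (λ j → b j * x j))

  ·-scale : ∀ {e} k (a x : Point e) → (λ j → k * a j) · x ≈ k * (a · x)
  ·-scale k a x = trans (sum-cong (λ j → *-assoc k (a j) (x j))) (sym (*-distribˡ-sum k (λ j → a j * x j)))

  ·-neg : ∀ {e} (a x : Point e) → (λ j → - a j) · x ≈ - (a · x)
  ·-neg a x = trans (sum-cong (λ j → sym (-‿distribˡ-* (a j) (x j)))) (sum-neg (λ j → a j * x j))

  ·-comm : ∀ {e} (a x : Point e) → a · x ≈ x · a
  ·-comm a x = sum-cong (λ j → *-comm (a j) (x j))

  ·-comb : ∀ {e m} (a : Point e) w (q : Fin m → Point e) → a · comb w q ≈ sum (λ i → w i * (a · q i))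
  ·-comb a w q = begin
    sum (λ j → a j * sum (λ i → w i * q i j))     ≈⟨ sum-cong (λ j → *-distribˡ-sum (a j) (λ i → w i * q i j)) ⟩
    sum (λ j → sum (λ i → a j * (w i * q i j)))   ≈⟨ ∑-comm (λ j i → a j * (w i * q i j)) ⟩
    sum (λ i → sum (λ j → a j * (w i * q i j)))   ≈⟨ sum-cong (λ i → sum-cong (λ j → swap (a j) (w i) (q i j))) ⟩
    sum (λ i → sum (λ j → w i * (a j * q i j)))   ≈⟨ sum-cong (λ i → *-distribˡ-sum (w i) (λ j → a j * q i j)) ⟨
    sum (λ i → w i * (a · q i))                   ∎
    where
    swap : ∀ x y z → x * (y * z) ≈ y * (x * z)
    swap x y z = trans (sym (*-assoc x y z)) (trans (*-congʳ (*-comm x y)) (*-assoc y x z))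

  -- Fourier–Motzkin elimination for homogeneous systems of weak and strict
  -- inequalities. It serves only to decide which index sets are faces, so that
  -- sums over all faces can be formed; see face?.

  Row : ℕ → Set c
  Row n = Bool × Vector Carrier n

  Sat : ∀ {n} → Vector Carrier n → Row n → Set ℓ₂
  Sat x (s , a) = Sgn s (a · x)

  Above Below : ∀ {n} → Carrier → Vector Carrier n → Row n → Set ℓ₂
  Above x₀ x (s , a) = Sgn s (x₀ + a · x)
  Below x₀ x (s , a) = Sgn s (- x₀ + a · x)

  record Split {n} (rs : List (Row (suc n))) : Set ℓ where
    field
      zs ls us : List (Row n)
      to   : ∀ x → All (Sat x) rs →
             All (Sat (tail x)) zs × All (Above (head x) (tail x)) ls × All (Below (head x) (tail x)) us
      from : ∀ x → All (Sat (tail x)) zs → All (Above (head x) (tail x)) ls → All (Below (head x) (tail x)) us →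
             All (Sat x) rs

  rescale⁺ : ∀ s {k y v v′ u} → Sgn true k → k * y ≈ u → k * v ≈ v′ → Sgn s (y + v) → Sgn s (u + v′)
  rescale⁺ s {k} {y} {v} k>0 p q r = sgn-resp s (trans (distribˡ k y v) (+-cong p q)) (sgn-* s k>0 r)

  rescale⁻ : ∀ s {b k y v v′ u} → Sgn true b → b * k ≈ 1# → k * y ≈ u → k * v ≈ v′ → Sgn s (u + v′) → Sgn s (y + v)
  rescale⁻ s {b} {k} {y} {v} b>0 bk p q r =
    rescale⁺ s b>0 (trans (*-congˡ (sym p)) (cancel y)) (trans (*-congˡ (sym q)) (cancel v)) r
    where
    cancel : ∀ z → b * (k * z) ≈ z
    cancel z = trans (sym (*-assoc b k z)) (trans (*-congʳ bk) (*-identityˡ z))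

  split : ∀ {n} (rs : List (Row (suc n))) → Split rs
  split [] = record
    { zs = [] ; ls = [] ; us = [] ; to = λ _ _ → [] , [] , [] ; from = λ _ _ _ _ → [] }
  split {n} ((s , a) ∷ rs) = go (head a ≲? 0#) (0# ≲? head a)
    where
    open Split (split rs)
    go : Dec (head a ≲ 0#) → Dec (0# ≲ head a) → Split ((s , a) ∷ rs)
    go (no a>0) _ with pos-inverse a>0
    ... | k , k>0 , ak≈1 = record
      { zs = zs ; ls = (s , λ j → k * tail a j) ∷ ls ; us = us
      ; to = λ x → λ where
          (p ∷ ps) → let z , l , u = to x ps in
            z , rescale⁺ s k>0 (eq x) (sym (·-scale k (tail a) (tail x))) p ∷ l , u
      ; from = λ x → λ where
          z (p ∷ l) u → rescale⁻ s a>0 ak≈1 (eq x) (sym (·-scale k (tail a) (tail x))) p ∷ from x z l u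
      }
      where
      eq : ∀ x → k * (head a * head x) ≈ head x
      eq x = trans (sym (*-assoc _ _ _)) (trans (*-congʳ (trans (*-comm k _) ak≈1)) (*-identityˡ _))
    go (yes a≲0) (no a<0) with pos-inverse {x = - head a} (λ p → a<0 (≲-respʳ-≈ (-‿involutive _) (neg-≲ p)))
    ... | k , k>0 , -ak≈1 = record
      { zs = zs ; ls = ls ; us = (s , λ j → k * tail a j) ∷ us
      ; to = λ x → λ where
          (p ∷ ps) → let z , l , u = to x ps in
            z , l , rescale⁺ s k>0 (eq x) (sym (·-scale k (tail a) (tail x))) p ∷ u
      ; from = λ x → λ where
          z l (p ∷ u) → rescale⁻ s -a>0 -ak≈1 (eq x) (sym (·-scale k (tail a) (tail x))) p ∷ from x z l u
      }
      where
      -a>0 : Sgn true (- head a)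
      -a>0 p = a<0 (≲-respʳ-≈ (-‿involutive _) (neg-≲ p))
      eq : ∀ x → k * (head a * head x) ≈ - head x
      eq x = begin
        k * (head a * head x)         ≈⟨ *-assoc _ _ _ ⟨
        k * head a * head x           ≈⟨ *-congʳ (*-comm k _) ⟩
        head a * k * head x           ≈⟨ *-congʳ (-‿involutive _) ⟨
        - - (head a * k) * head x     ≈⟨ *-congʳ (-‿cong (-‿distribˡ-* _ k)) ⟩
        - (- head a * k) * head x     ≈⟨ *-congʳ (-‿cong -ak≈1) ⟩
        - 1# * head x                 ≈⟨ -‿distribˡ-* 1# _ ⟨
        - (1# * head x)               ≈⟨ -‿cong (*-identityˡ _) ⟩
        - head x                      ∎
    go (yes a≲0) (yes 0≲a) = record
      { zs = (s , tail a) ∷ zs ; ls = ls ; us = us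
      ; to = λ x → λ where
          (p ∷ ps) → let z , l , u = to x ps in sgn-resp s (eq x) p ∷ z , l , u
      ; from = λ x → λ where
          (p ∷ z) l u → sgn-resp s (sym (eq x)) p ∷ from x z l u
      }
      where
      eq : ∀ x → a · x ≈ tail a · tail x
      eq x = trans (+-congʳ (trans (*-congʳ (≲-antisym a≲0 0≲a)) (zeroˡ _))) (+-identityˡ _)

  Bound : Set c
  Bound = Bool × Carrier

  Ok : Carrier → Bound → Set ℓ₂
  Ok x (s , v) = Sgn s (x + v)

  _⇛_ : Bound → Bound → Set (c ⊔ ℓ₂)
  b ⇛ b′ = ∀ x → Ok x b → Ok x b′

  ok-mono : ∀ s {u v} → u ≲ v → (s , u) ⇛ (s , v)
  ok-mono false u≲v x p   = ≲-trans p (+-monoʳ-≲ x u≲v)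
  ok-mono true  u≲v x p r = p (≲-trans (+-monoʳ-≲ x u≲v) r)

  ok-strict : ∀ s t {u v} → ¬ v ≲ u → (s , u) ⇛ (t , v)
  ok-strict s t {u} {v} v≰u x p = lift t (λ r → v≰u (cancel (≲-trans r (sgn-weaken s p))))
    where
    lift : ∀ t {y} → Sgn true y → Sgn t y
    lift true  q = q
    lift false q = sgn-weaken true q
    e : ∀ y → - x + (x + y) ≈ y
    e y = trans (sym (+-assoc _ _ _)) (trans (+-congʳ (-‿inverseˡ x)) (+-identityˡ y))
    cancel : x + v ≲ x + u → v ≲ u
    cancel r = ≲-respʳ-≈ (e u) (≲-respˡ-≈ (e v) (+-monoʳ-≲ (- x) r))

  ⇛-total : ∀ b b′ → b ⇛ b′ ⊎ b′ ⇛ b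
  ⇛-total (s , u) (t , v) with u ≲? v | v ≲? u
  ... | _     | no v≰u = inj₁ (ok-strict s t v≰u)
  ... | no u≰v | yes _ = inj₂ (ok-strict t s u≰v)
  ⇛-total (true  , u) (t     , v) | yes p | yes q = inj₁ λ x r → proj₂ (sgn-∨ true t (ok-mono true p x r))
  ⇛-total (false , u) (true  , v) | yes p | yes q = inj₂ λ x r → sgn-weaken true (ok-mono true q x r)
  ⇛-total (false , u) (false , v) | yes p | yes q = inj₁ (ok-mono false p)

  bound : ∀ {n} → Vector Carrier n → Row n → Bound
  bound x (s , a) = s , a · x

  strongest : ∀ {n} x (r : Row n) rs → ∃[ b ] b ∈ₗ r ∷ rs × (∀ y → Ok y (bound x b) → All (Ok y ∘ bound x) (r ∷ rs))
  strongest x r []        = r , here ≡.refl , λ _ p → p ∷ []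
  strongest x r (r′ ∷ rs) with strongest x r′ rs
  ... | b , b∈ , dom with ⇛-total (bound x r) (bound x b)
  ...   | inj₁ r⇛b = r , here ≡.refl , λ y p → p ∷ dom y (r⇛b y p)
  ...   | inj₂ b⇛r = b , there b∈ , λ y p → b⇛r y p ∷ dom y p

  _⊞_ : ∀ {n} → Row n → Row n → Row n
  (s , a) ⊞ (t , b) = s ∨ t , λ j → a j + b j

  half : ∃[ h ] Sgn true h × (∀ v → h * (v + v) ≈ v)
  half with pos-inverse (sgn-+ true true 1>0 1>0)
  ... | h , h>0 , 2h≈1 = h , h>0 , eq
    where
    eq : ∀ v → h * (v + v) ≈ v
    eq v = begin
      h * (v + v)               ≈⟨ *-congˡ (+-cong (*-identityˡ v) (*-identityˡ v)) ⟨
      h * (1# * v + 1# * v)     ≈⟨ *-congˡ (distribʳ v 1# 1#) ⟨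
      h * ((1# + 1#) * v)       ≈⟨ *-assoc _ _ _ ⟨
      h * (1# + 1#) * v         ≈⟨ *-congʳ (trans (*-comm h _) 2h≈1) ⟩
      1# * v                    ≈⟨ *-identityˡ v ⟩
      v                         ∎

  between : ∀ s t {u v} → Sgn (s ∨ t) (u + v) → ∃[ y ] Ok y (s , u) × Ok (- y) (t , v)
  between s t {u} {v} p with half
  ... | h , h>0 , dbl = h * (v + - u) , proj₁ (sgn-∨ s t (mid lower)) , proj₂ (sgn-∨ s t (mid upper))
    where
    mid : ∀ {z} → h * (u + v) ≈ z → Sgn (s ∨ t) z
    mid eq = sgn-resp (s ∨ t) eq (sgn-* (s ∨ t) h>0 p)
    lower : h * (u + v) ≈ h * (v + - u) + u
    lower = begin
      h * (u + v)                     ≈⟨ *-congˡ (trans (+-comm u v) (+-congʳ (sym (cancel-+- u v)))) ⟩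
      h * ((v + - u + u) + u)         ≈⟨ *-congˡ (+-assoc _ _ _) ⟩
      h * ((v + - u) + (u + u))       ≈⟨ distribˡ h _ _ ⟩
      h * (v + - u) + h * (u + u)     ≈⟨ +-congˡ (dbl u) ⟩
      h * (v + - u) + u               ∎
    neg : u + - v ≈ - (v + - u)
    neg = begin
      u + - v         ≈⟨ +-comm u (- v) ⟩
      - v + u         ≈⟨ +-congˡ (-‿involutive u) ⟨
      - v + - - u     ≈⟨ -‿+-comm v (- u) ⟩
      - (v + - u)     ∎
    upper : h * (u + v) ≈ - (h * (v + - u)) + v
    upper = begin
      h * (u + v)                     ≈⟨ *-congˡ (+-congʳ (sym (cancel-+- v u))) ⟩
      h * ((u + - v + v) + v)         ≈⟨ *-congˡ (+-assoc _ _ _) ⟩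
      h * ((u + - v) + (v + v))       ≈⟨ distribˡ h _ _ ⟩
      h * (u + - v) + h * (v + v)     ≈⟨ +-cong (trans (*-congˡ neg) (sym (-‿distribʳ-* h _))) (dbl v) ⟩
      - (h * (v + - u)) + v           ∎

  ok-far : ∀ s v → Ok (1# + - v) (s , v)
  ok-far s v = sgn-resp s (sym (cancel-+- v 1#)) (pos s)
    where
    pos : ∀ s → Sgn s 1#
    pos true  = 1>0
    pos false = 0≲1

  pick : ∀ {n} x (ls us : List (Row n)) → All (Sat x) (cartesianProductWith _⊞_ ls us) →
         ∃[ y ] All (Above y x) ls × All (Below y x) us
  pick x [] []       _ = 0# , [] , []
  pick x (l ∷ ls) [] _ with strongest x l ls
  ... | (s , a) , _ , dom = 1# + - (a · x) , dom _ (ok-far s (a · x)) , []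
  pick x [] (u ∷ us) _ with strongest x u us
  ... | (t , b) , _ , dom =
    - (1# + - (b · x)) , [] , dom _ (sgn-resp t (+-congʳ (sym (-‿involutive _))) (ok-far t (b · x)))
  pick x (l ∷ ls) (u ∷ us) ps with strongest x l ls | strongest x u us
  ... | (s , a) , l∈ , domˡ | (t , b) , u∈ , domᵘ
    with between s t (sgn-resp (s ∨ t) (·-+ a b x) (All.lookup ps (∈-cartesianProductWith⁺ _⊞_ l∈ u∈)))
  ...   | y , p , q = y , domˡ y p , domᵘ (- y) q

  combined : ∀ {n} y x (ls us : List (Row n)) → All (Above y x) ls → All (Below y x) us →
             All (Sat x) (cartesianProductWith _⊞_ ls us)
  combined y x ls us ps qs = All.tabulate λ r∈ → go (∈-cartesianProductWith⁻ _⊞_ ls us r∈)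
    where
    go : ∀ {r} → ∃[ l ] ∃[ u ] l ∈ₗ ls × u ∈ₗ us × r ≡ l ⊞ u → Sat x r
    go ((s , a) , (t , b) , l∈ , u∈ , ≡.refl) =
      sgn-resp (s ∨ t) eq (sgn-+ s t (All.lookup ps l∈) (All.lookup qs u∈))
      where
      eq : (y + a · x) + (- y + b · x) ≈ (λ j → a j + b j) · x
      eq = begin
        (y + a · x) + (- y + b · x)     ≈⟨ +-congʳ (+-comm y _) ⟩
        (a · x + y) + (- y + b · x)     ≈⟨ +-assoc _ _ _ ⟩
        a · x + (y + (- y + b · x))     ≈⟨ +-congˡ (+-assoc _ _ _) ⟨
        a · x + (y + - y + b · x)       ≈⟨ +-congˡ (trans (+-congʳ (-‿inverseʳ y)) (+-identityˡ _)) ⟩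
        a · x + b · x                   ≈⟨ ·-+ a b x ⟨
        (λ j → a j + b j) · x           ∎

  feasible? : ∀ {n} (rs : List (Row n)) → Dec (∃[ x ] All (Sat x) rs)
  feasible? {zero} rs =
    map′ (λ ps → (λ ()) , ps) (λ (x , ps) → All.map (λ p → p) ps) (All.all? (λ r → sgn? (proj₁ r) 0#) rs)
  feasible? {suc n} rs = map′ fwd bwd (feasible? (zs ++ cartesianProductWith _⊞_ ls us))
    where
    open Split (split rs)
    fwd : ∃[ x ] All (Sat x) (zs ++ cartesianProductWith _⊞_ ls us) → ∃[ x ] All (Sat x) rs
    fwd (x , ps) with pick x ls us (++⁻ʳ zs ps)
    ... | y , l , u = y ◂ x , from (y ◂ x) (++⁻ˡ zs ps) l u
    bwd : ∃[ x ] All (Sat x) rs → ∃[ x ] All (Sat x) (zs ++ cartesianProductWith _⊞_ ls us)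
    bwd (x , ps) = let z , l , u = to x ps in tail x , ++⁺ z (combined (head x) (tail x) ls us l u)

  hull : ∀ {e m} → (Fin m → Point e) → Subset m → Pred (Point e) ℓ
  hull q S x = ∃[ w ] (∀ i → 0# ≲ w i) × (∀ i → i ∉ S → w i ≈ 0#) × sum w ≈ 1# × x ≋ comb w q

  conv : ∀ {e m} → (Fin m → Point e) → Pred (Point e) ℓ
  conv q = hull q ⊤

  AffinelyIndependent : ∀ {e m} → (Fin m → Point e) → Set (c ⊔ ℓ₁)
  AffinelyIndependent q = ∀ μ → sum μ ≈ 0# → (∀ j → comb μ q j ≈ 0#) → ∀ i → μ i ≈ 0#

  HasDimension : ∀ {e} → Pred (Point e) ℓ → ℕ → Set ℓ
  HasDimension {e} X d =
    (∃[ q ] AffinelyIndependent {e} {suc d} q × (∀ i → q i ∈ₚ X)) ×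
    ¬ (∃[ q ] AffinelyIndependent {e} {suc (suc d)} q × (∀ i → q i ∈ₚ X))

  IsSimplex : ∀ {e} → ℕ → Pred (Point e) ℓ → Set ℓ
  IsSimplex {e} k X = ∃[ q ] AffinelyIndependent {e} {suc k} q × X ≐ conv q

  IsFaceOf : ∀ {e ℓ′} → Pred (Point e) ℓ′ → Pred (Point e) ℓ → Set (ℓ ⊔ ℓ′)
  IsFaceOf F X =
    ∃[ a ] ∃[ β ] (∀ {x} → x ∈ₚ X → a · x ≲ β) × F ≐ (λ x → x ∈ₚ X × a · x ≈ β)

  IsVertexOf : ∀ {e} → Point e → Pred (Point e) ℓ → Set ℓ
  IsVertexOf v X = IsFaceOf (_≋ v) X

  Separates : ∀ {e} → Point e → Pred (Point e) ℓ → Set ℓ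
  Separates c X = ∀ v w → IsVertexOf v X → IsVertexOf w X → c · v ≈ c · w → v ≋ w

  IsApexOf : ∀ {e} → Point e → Point e → Pred (Point e) ℓ → Set ℓ
  IsApexOf c v X = IsVertexOf v X × (∀ {x} → x ∈ₚ X → c · v ≲ c · x)

  sum-* : ∀ {n} (f : Vector Carrier n) k → sum (λ i → f i * k) ≈ sum f * k
  sum-* f k = sym (*-distribʳ-sum k f)

  δ : ∀ {m} → Fin m → Fin m → Carrier
  δ zero    zero    = 1#
  δ zero    (suc j) = 0#
  δ (suc i) zero    = 0#
  δ (suc i) (suc j) = δ i j

  δ-nonNeg : ∀ {m} (i j : Fin m) → 0# ≲ δ i j
  δ-nonNeg zero    zero    = 0≲1
  δ-nonNeg zero    (suc j) = ≲-refl
  δ-nonNeg (suc i) zero    = ≲-refl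
  δ-nonNeg (suc i) (suc j) = δ-nonNeg i j

  δ-off : ∀ {m} (i j : Fin m) → i ≢ j → δ i j ≈ 0#
  δ-off zero    zero    i≢j = contradiction ≡.refl i≢j
  δ-off zero    (suc j) i≢j = refl
  δ-off (suc i) zero    i≢j = refl
  δ-off (suc i) (suc j) i≢j = δ-off i j (i≢j ∘ ≡.cong suc)

  sum-δ : ∀ {m} (i : Fin m) (f : Vector Carrier m) → sum (λ j → δ i j * f j) ≈ f i
  sum-δ zero    f = trans (+-cong (*-identityˡ _) (sum-≈0 (λ j → zeroˡ (f (suc j))))) (+-identityʳ _)
  sum-δ (suc i) f = trans (+-cong (zeroˡ _) (sum-δ i (f ∘ suc))) (+-identityˡ _)

  ∈-hull : ∀ {e m} (q : Fin m → Point e) {S i} → i ∈ S → q i ∈ₚ hull q S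
  ∈-hull q {S} {i} i∈S =
    δ i , δ-nonNeg i , (λ j j∉S → δ-off i j (λ { ≡.refl → j∉S i∈S })) ,
    trans (sum-cong (λ j → trans (sym (*-identityˡ (δ i j))) (*-comm 1# (δ i j)))) (sum-δ i (λ _ → 1#)) ,
    (λ j → sym (sum-δ i (λ k → q k j)))

  -- For a point x of the hull with weights w, β - a · x is the w-average of the
  -- numbers β - a · q i.
  slack : ∀ {e m} (q : Fin m → Point e) a β {w x} → sum w ≈ 1# → x ≋ comb w q →
          β + - (a · x) ≈ sum (λ i → w i * (β + - (a · q i)))
  slack q a β {w} {x} w≈1 x≋ = begin
    β + - (a · x)
      ≈⟨ +-cong (trans (sym (*-identityˡ β)) (*-congʳ (sym w≈1))) (-‿cong (trans (sum-cong (λ j → *-congˡ (x≋ j))) (·-comb a w q))) ⟩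
    sum w * β + - sum (λ i → w i * (a · q i))
      ≈⟨ +-cong (sum-* w β) (sum-neg (λ i → w i * (a · q i))) ⟨
    sum (λ i → w i * β) + sum (λ i → - (w i * (a · q i)))
      ≈⟨ ∑-distrib-+ (λ i → w i * β) (λ i → - (w i * (a · q i))) ⟨
    sum (λ i → w i * β + - (w i * (a · q i)))
      ≈⟨ sum-cong (λ i → trans (+-congˡ (-‿distribʳ-* (w i) _)) (sym (distribˡ (w i) β _))) ⟩
    sum (λ i → w i * (β + - (a · q i)))
      ∎

  module _ {e m} (p : Fin m → Point e) where

    -- A nonempty face of hull p S is recorded as the set T of indices of all
    -- the generators p i, i ∈ S, that it contains; saturation makes
    -- T ↦ hull p T injective on these records, even if some generators
    -- coincide or are not vertices.
    Face : Subset m → Subset m → Set ℓ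
    Face S T =
      Nonempty T × T ⊆ S × (∀ {i} → i ∈ S → p i ∈ₚ hull p T → i ∈ T) × IsFaceOf (hull p T) (hull p S)

    data Side (S T : Subset m) (i : Fin m) (x : Carrier) : Set ℓ₂ where
      on   : i ∈ T → 0# ≲ x → 0# ≲ - x → Side S T i x
      off  : i ∈ S → i ∉ T → ¬ x ≲ 0# → Side S T i x
      free : i ∉ S → i ∉ T → Side S T i x

    slackOf : Point e → Carrier → Fin m → Carrier
    slackOf a β i = β + - (a · p i)

    Supports : Subset m → Subset m → Point e → Carrier → Set ℓ₂
    Supports S T a β = ∀ i → Side S T i (slackOf a β i)

    row : Fin m → Vector Carrier (suc e)
    row i = 1# ◂ λ j → - p i j

    rows : Subset m → Subset m → Fin m → List (Row (suc e))
    rows S T i with i ∈? T | i ∈? S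
    ... | yes _ | _     = (false , row i) ∷ (false , λ j → - row i j) ∷ []
    ... | no  _ | yes _ = (true , row i) ∷ []
    ... | no  _ | no  _ = []

    row-eq : ∀ i (y : Vector Carrier (suc e)) → row i · y ≈ slackOf (tail y) (head y) i
    row-eq i y = +-cong (*-identityˡ _) (trans (·-neg (p i) (tail y)) (-‿cong (·-comm (p i) (tail y))))

    rows⁺ : ∀ S T i y → Side S T i (slackOf (tail y) (head y) i) → All (Sat y) (rows S T i)
    rows⁺ S T i y s with i ∈? T | i ∈? S
    rows⁺ S T i y (on _ l u)     | yes _   | _ =
      sgn-resp false (sym (row-eq i y)) l ∷
      sgn-resp false (sym (trans (·-neg (row i) y) (-‿cong (row-eq i y)))) u ∷ []
    rows⁺ S T i y (off _ i∉T _)  | yes i∈T | _ = contradiction i∈T i∉T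
    rows⁺ S T i y (free _ i∉T)   | yes i∈T | _ = contradiction i∈T i∉T
    rows⁺ S T i y (on i∈T _ _)   | no i∉T  | yes _ = contradiction i∈T i∉T
    rows⁺ S T i y (off _ _ l)    | no _    | yes _ = sgn-resp true (sym (row-eq i y)) l ∷ []
    rows⁺ S T i y (free i∉S _)   | no _    | yes i∈S = contradiction i∈S i∉S
    rows⁺ S T i y _              | no _    | no _ = []

    rows⁻ : ∀ S T i y → All (Sat y) (rows S T i) → Side S T i (slackOf (tail y) (head y) i)
    rows⁻ S T i y ps with i ∈? T | i ∈? S
    rows⁻ S T i y (l ∷ u ∷ []) | yes i∈T | _ =
      on i∈T (sgn-resp false (row-eq i y) l) (sgn-resp false (trans (·-neg (row i) y) (-‿cong (row-eq i y))) u)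
    rows⁻ S T i y (l ∷ [])     | no i∉T | yes i∈S = off i∈S i∉T (sgn-resp true (row-eq i y) l)
    rows⁻ S T i y []           | no i∉T | no i∉S  = free i∉S i∉T

    supported? : ∀ S T → Dec (∃[ a ] ∃[ β ] Supports S T a β)
    supported? S T = map′
      (λ (y , ps) → tail y , head y , λ i → rows⁻ S T i y (tabulate⁻ (concat⁻ ps) i))
      (λ (a , β , s) → β ◂ a , concat⁺ (tabulate⁺ (λ i → rows⁺ S T i (β ◂ a) (s i))))
      (feasible? (concat (tabulate (rows S T))))

    side-nonNeg : ∀ {S T i x} → Side S T i x → i ∈ S → 0# ≲ x
    side-nonNeg (on _ l _)   _   = l
    side-nonNeg (off _ _ l)  _   = sgn-weaken true l
    side-nonNeg (free i∉S _) i∈S = contradiction i∈S i∉S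

    side-≈0 : ∀ {S T i x} → Side S T i x → i ∈ T → x ≈ 0#
    side-≈0 (on _ l u)     _   = ≲-antisym (neg-≲⁻ u) l
    side-≈0 (off _ i∉T _)  i∈T = contradiction i∈T i∉T
    side-≈0 (free _ i∉T)   i∈T = contradiction i∈T i∉T

    side-∈ : ∀ {S T i x} → Side S T i x → i ∈ S → x ≈ 0# → i ∈ T
    side-∈ (on i∈T _ _)   _   _   = i∈T
    side-∈ (off _ _ l)    _   x≈0 = contradiction x≈0 (pos⇒≉0 l)
    side-∈ (free i∉S _)   i∈S _   = contradiction i∈S i∉S

    supports⇒face : ∀ {S T} → Nonempty T → T ⊆ S → ∃[ a ] ∃[ β ] Supports S T a β → Face S T
    supports⇒face {S} {T} ne T⊆S (a , β , s) = ne , T⊆S , saturated , a , β , valid , T⇒S , S⇒T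
      where
      term-nonNeg : ∀ w → (∀ i → 0# ≲ w i) → (∀ i → i ∉ S → w i ≈ 0#) → ∀ i → 0# ≲ w i * slackOf a β i
      term-nonNeg w w≥0 w-off i with i ∈? S
      ... | yes i∈S = *-nonNeg (w≥0 i) (side-nonNeg (s i) i∈S)
      ... | no  i∉S = ≲-reflexive (sym (trans (*-congʳ (w-off i i∉S)) (zeroˡ _)))

      valid : ∀ {x} → x ∈ₚ hull p S → a · x ≲ β
      valid (w , w≥0 , w-off , w≈1 , x≋) =
        diff⁻ (≲-respʳ-≈ (sym (slack p a β w≈1 x≋)) (sum-nonNeg (term-nonNeg w w≥0 w-off)))

      T⇒S : ∀ {x} → x ∈ₚ hull p T → x ∈ₚ hull p S × a · x ≈ β
      T⇒S {x} (w , w≥0 , w-off , w≈1 , x≋) =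
        (w , w≥0 , (λ i i∉S → w-off i (i∉S ∘ T⊆S)) , w≈1 , x≋) ,
        diff≈0 (trans (slack p a β w≈1 x≋) (sum-≈0 zeros))
        where
        zeros : ∀ i → w i * slackOf a β i ≈ 0#
        zeros i with i ∈? T
        ... | yes i∈T = trans (*-congˡ (side-≈0 (s i) i∈T)) (zeroʳ _)
        ... | no  i∉T = trans (*-congʳ (w-off i i∉T)) (zeroˡ _)

      S⇒T : ∀ {x} → x ∈ₚ hull p S × a · x ≈ β → x ∈ₚ hull p T
      S⇒T {x} ((w , w≥0 , w-off , w≈1 , x≋) , ax≈β) = w , w≥0 , w-off′ , w≈1 , x≋
        where
        zeros : ∀ i → w i * slackOf a β i ≈ 0#
        zeros = sum≈0⇒≈0 (term-nonNeg w w≥0 w-off) (trans (sym (slack p a β w≈1 x≋)) (≈⇒diff ax≈β))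
        w-off′ : ∀ i → i ∉ T → w i ≈ 0#
        w-off′ i i∉T with i ∈? S
        ... | no  i∉S = w-off i i∉S
        ... | yes i∈S = *-cancel-≈0 (λ x≈0 → i∉T (side-∈ (s i) i∈S x≈0)) (trans (*-comm _ _) (zeros i))

      saturated : ∀ {i} → i ∈ S → p i ∈ₚ hull p T → i ∈ T
      saturated i∈S pi∈T = side-∈ (s _) i∈S (≈⇒diff (proj₂ (T⇒S pi∈T)))

    face⇒supports : ∀ {S T} → Face S T → ∃[ a ] ∃[ β ] Supports S T a β
    face⇒supports {S} {T} (ne , T⊆S , saturated , a , β , valid , T⇒S , S⇒T) = a , β , sides
      where
      sides : Supports S T a β
      sides i with i ∈? T | i ∈? S
      ... | no i∉T | no i∉S = free i∉S i∉T
      ... | yes i∈T | _ = on i∈T (≲-reflexive (sym eq)) (neg-≲ (≲-reflexive eq))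
        where
        eq : slackOf a β i ≈ 0#
        eq = ≈⇒diff (proj₂ (T⇒S (∈-hull p i∈T)))
      ... | no i∉T | yes i∈S = off i∈S i∉T λ r →
        i∉T (saturated i∈S (S⇒T (∈-hull p i∈S ,
          diff≈0 (≲-antisym r (diff⁺ (valid (∈-hull p i∈S)))))))

    face? : ∀ S T → Dec (Face S T)
    face? S T = map′
      (λ (ne , T⊆S , s) → supports⇒face ne (λ {i} → T⊆S {i}) s)
      (λ f@(ne , T⊆S , _) → ne , (λ {i} → T⊆S {i}) , face⇒supports f)
      (nonempty? T ×-dec T ⊆? S ×-dec supported? S T)

    IsPoint : Subset m → Set ℓ₁
    IsPoint S = ∀ i → i ∈ S → ∀ j → j ∈ S → p i ≋ p j

    isPoint? : ∀ S → Dec (IsPoint S)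
    isPoint? S = all? λ i → i ∈? S →-dec all? λ j → j ∈? S →-dec all? λ k → p i k ≟ p j k

    faces : Subset m → List (Subset m)
    faces S = filter (face? S) (allSubsets m)

    -- The apex of hull p F is p (apex F). If generators coincide, apex F may be
    -- any index of that point; by saturation p (apex F) lies in a face hull p G
    -- exactly when apex F ∈ G. Values at index sets that are not faces are unused.
    record ApexSystem (c : Point e) : Set ℓ where
      field
        apex   : Subset m → Fin m
        isApex : ∀ {F} → Face ⊤ F → IsApexOf c (p (apex F)) (hull p F)

    module _ {c} (V : ApexSystem c) where

      open ApexSystem V

      -- P(n) and P(n)♯ for hull p S. The recursion is on a bound b for the
      -- number of generators in S, in place of dim S: proper faces have fewer
      -- generators, so for nonempty S any b ≥ ∣ S ∣ gives the same value and
      -- the clauses for b = 0 are not reached. The case dim S = 0 is that of a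
      -- single point. Integer values keep the subtraction untruncated.
      number interior : ℕ → (S : Subset m) → Dec (IsPoint S) → ℕ → ℤ

      number zero    S _           n             = + 0
      number (suc b) S (yes _)     zero          = + 0
      number (suc b) S (yes _)     (suc n)       = + 1
      number (suc b) S (no _)      zero          = + 0
      number (suc b) S (no _)      (suc zero)    = + 1
      number (suc b) S (no ¬point) (suc (suc n)) =
        number (suc b) S (no ¬point) (suc n) ℤ.+
        ∑ (filter (λ F → ¬? (apex S ∈? F)) (faces S)) (λ F → interior b F (isPoint? F) (suc (suc n)))

      interior zero    S _           n             = + 0
      interior (suc b) S (yes _)     zero          = + 0
      interior (suc b) S (yes _)     (suc n)       = + 1
      interior (suc b) S (no _)      zero          = + 0
      interior (suc b) S (no _)      (suc zero)    = + 0
      interior (suc b) S (no ¬point) (suc (suc n)) =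
        number (suc b) S (no ¬point) (suc (suc n)) ℤ.-
        ∑ (filter (λ F → ¬? (≡-dec Bool._≟_ F S)) (faces S)) (λ F → interior b F (isPoint? F) (suc (suc n)))

      polytopeNumber : ℕ → ℤ
      polytopeNumber = number ∣ ⊤ {m} ∣ ⊤ (isPoint? ⊤)

      -- The pointed triangulation of a d-polytope, as a set of convex sets. The
      -- chain is G 0 ⊋ … ⊋ G k; for faces F, p i ∈ hull p F amounts to i ∈ F and
      -- inclusion of faces to inclusion of index sets.
      Triangulation : ℕ → Pred (Pred (Point e) ℓ) ℓ
      Triangulation d X = X ≐ ∅ ⊎
        ∃[ k ] k ≤ d × Σ[ G ∈ (Fin (suc k) → Subset m) ]
          (∀ i → Face ⊤ (G i)) ×
          (∀ (i : Fin k) → G (suc i) ⊂ G (inject₁ i)) ×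
          (∀ (i : Fin k) → apex (G (inject₁ i)) ∉ G (suc i)) ×
          X ≐ conv (λ i → p (apex (G i)))

  -- Sets of points are counted up to extensional equality.
  HasSize : ∀ {e ℓ′} → Pred (Pred (Point e) ℓ) ℓ′ → ℕ → Set (lsuc ℓ ⊔ ℓ′)
  HasSize {e} 𝒳 n = Σ[ X ∈ (Fin n → Pred (Point e) ℓ) ]
    (∀ i → X i ∈ₚ 𝒳) ×
    (∀ i j → X i ≐ X j → i ≡ j) ×
    (∀ {Y} → Y ∈ₚ 𝒳 → ∃[ i ] Y ≐ X i)

-- Let n = N + 2, so that α k (n - (k + 1)) is the binomial coefficient N C k. A simplex of the
-- triangulation whose smallest containing face is F is either the vertex F or the cone from the
-- apex of F over a simplex with smallest face G, where G avoids the apex of F and F is the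
-- smallest face containing both. Writing (T f) F for the sum of f G over these G, the k-simplexes
-- with smallest face F are counted by T^k applied to the indicator of the vertices, so the formula
-- to be proved says that the interior numbers are (1 + T)^N applied to this indicator. That
-- satisfies the recursion for polytope numbers because, given a face G of S that avoids the apex
-- v of S, exactly one face of S is generated by v and G: summing T f over the faces that contain
-- v gives the sum of f over the faces that do not.

module Submission where

open import Algebra.Bundles using (CommutativeRing)
open import Data.Bool as Bool using (true; false)
open import Data.Empty using (⊥-elim)
open import Data.Fin using (Fin; zero; suc; inject₁; punchIn)
import Data.Fin.Properties as Fin
open import Data.Fin.Subset using (Subset; inside; outside; ⊤; ⋂; ∣_∣; Nonempty; _∈_; _∉_; _⊆_; _⊂_)
open import Data.Fin.Subset.Properties
  using (_∈?_; _⊆?_; ⊆-antisym; ⊆⊤; ∈⊤; p⊆q⇒∣p∣≤∣q∣; p⊂q⇒∣p∣<∣q∣; p∩q⊆p; p∩q⊆q; x∈p∩q⁺; ∣⁅x⁆∣≡1; x∈⁅y⁆⇒x≡y)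
open import Data.Integer using (ℤ; +_)
import Data.Integer as ℤ using (_+_; _*_; _-_; -_)
import Data.Integer.Properties as ℤ
open import Data.Integer.Tactic.RingSolver using (solve-∀)
open import Data.List as List using (List; []; _∷_; _++_; map; filter; length; upTo; cartesianProductWith)
open import Data.List.Membership.Propositional using () renaming (_∈_ to _∈ₗ_)
open import Data.List.Membership.Propositional.Properties
  using (∈-filter⁺; ∈-filter⁻; ∈-++⁺ˡ; ∈-++⁺ʳ; ∈-map⁺; ∈-map⁻; ∈-lookup; ∈-upTo⁻; ∈-cartesianProductWith⁺)
import Data.List.Properties as List
open import Data.List.Relation.Unary.All as All using (All; []; _∷_)
open import Data.List.Relation.Unary.AllPairs using ([]; _∷_)
open import Data.List.Relation.Unary.Any as Any using (here; there)
open import Data.List.Relation.Unary.Any.Properties using (lookup-index)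
open import Data.List.Relation.Unary.Unique.Propositional using (Unique)
import Data.List.Relation.Unary.Unique.Propositional.Properties as Unique
open import Data.Nat as ℕ using (ℕ; zero; suc; s≤s)
open import Data.Nat.Combinatorics using (_C_; nCk+nC[k+1]≡[n+1]C[k+1]; k>n⇒nCk≡0)
import Data.Nat.Properties as ℕ
open import Data.Product using (∃; ∃-syntax; _×_; _,_; proj₁; proj₂)
open import Data.Sum using (_⊎_; inj₁; inj₂)
open import Data.Vec as Vec using (Vec; []; _∷_)
open import Data.Vec.Functional using (insertAt)
open import Data.Vec.Functional.Properties using (insertAt-lookup; insertAt-punchIn)
import Data.Vec.Properties as Vec
open import Defs
open import Function using (_∘_; id)
open import Level using (_⊔_)
open import Relation.Binary.PropositionalEquality as ≡ using (_≡_; _≢_; cong; cong₂; module ≡-Reasoning)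
open import Relation.Nullary using (¬_; Dec; yes; no; ¬?; contradiction)
open import Relation.Nullary.Decidable using (does; dec-true; _×-dec_; _→-dec_)
import Relation.Unary as U
open import Relation.Unary.Properties using (≐-refl; ≐-sym; ≐-trans)

-- Sums of indicators

𝟙 : ∀ {p} {P : Set p} → Dec P → ℤ
𝟙 (yes _) = + 1
𝟙 (no _)  = + 0

𝟙-yes : ∀ {p} {P : Set p} (P? : Dec P) → P → 𝟙 P? ≡ + 1
𝟙-yes (yes _) _ = ≡.refl
𝟙-yes (no ¬p) p = contradiction p ¬p

𝟙-no : ∀ {p} {P : Set p} (P? : Dec P) → ¬ P → 𝟙 P? ≡ + 0
𝟙-no (yes p) ¬p = contradiction p ¬p
𝟙-no (no _)  _  = ≡.refl

𝟙-cong : ∀ {p q} {P : Set p} {Q : Set q} (P? : Dec P) (Q? : Dec Q) → (P → Q) → (Q → P) → 𝟙 P? ≡ 𝟙 Q?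
𝟙-cong (yes p) Q? f g = ≡.sym (𝟙-yes Q? (f p))
𝟙-cong (no ¬p) Q? f g = ≡.sym (𝟙-no Q? (¬p ∘ g))

𝟙-× : ∀ {p q} {P : Set p} {Q : Set q} (P? : Dec P) (Q? : Dec Q) → 𝟙 (P? ×-dec Q?) ≡ 𝟙 P? ℤ.* 𝟙 Q?
𝟙-× (yes _) (yes _) = ≡.refl
𝟙-× (yes _) (no _)  = ≡.refl
𝟙-× (no _)  (yes _) = ≡.refl
𝟙-× (no _)  (no _)  = ≡.refl

𝟙-¬ : ∀ {p} {P : Set p} (P? : Dec P) x → x ≡ 𝟙 P? ℤ.* x ℤ.+ 𝟙 (¬? P?) ℤ.* x
𝟙-¬ (yes _) x = ≡.sym (≡.trans (ℤ.+-identityʳ _) (ℤ.*-identityˡ x))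
𝟙-¬ (no _)  x = ≡.sym (≡.trans (ℤ.+-identityˡ _) (ℤ.*-identityˡ x))

𝟙-*-cong : ∀ {p} {P : Set p} (P? : Dec P) {x y} → (P → x ≡ y) → 𝟙 P? ℤ.* x ≡ 𝟙 P? ℤ.* y
𝟙-*-cong (yes p) x≡y = cong (ℤ._*_ (+ 1)) (x≡y p)
𝟙-*-cong (no _)  x≡y = ≡.refl

module _ {a} {A : Set a} where

  ∑-cong : ∀ (xs : List A) {f g : A → ℤ} → (∀ {x} → x ∈ₗ xs → f x ≡ g x) → ∑ xs f ≡ ∑ xs g
  ∑-cong []       f≗g = ≡.refl
  ∑-cong (x ∷ xs) f≗g = cong₂ ℤ._+_ (f≗g (here ≡.refl)) (∑-cong xs (f≗g ∘ there))

  ∑-zero : ∀ (xs : List A) {f : A → ℤ} → (∀ {x} → x ∈ₗ xs → f x ≡ + 0) → ∑ xs f ≡ + 0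
  ∑-zero []       f≗0 = ≡.refl
  ∑-zero (x ∷ xs) f≗0 = cong₂ ℤ._+_ (f≗0 (here ≡.refl)) (∑-zero xs (f≗0 ∘ there))

  ∑-+ : ∀ (xs : List A) (f g : A → ℤ) → ∑ xs (λ x → f x ℤ.+ g x) ≡ ∑ xs f ℤ.+ ∑ xs g
  ∑-+ []       f g = ≡.refl
  ∑-+ (x ∷ xs) f g = ≡.trans (cong (λ s → f x ℤ.+ g x ℤ.+ s) (∑-+ xs f g)) (interchange (f x) (g x) (∑ xs f) (∑ xs g))
    where
    interchange : ∀ a b c d → a ℤ.+ b ℤ.+ (c ℤ.+ d) ≡ a ℤ.+ c ℤ.+ (b ℤ.+ d)
    interchange = solve-∀

  ∑-*ˡ : ∀ (xs : List A) k (f : A → ℤ) → ∑ xs (λ x → k ℤ.* f x) ≡ k ℤ.* ∑ xs f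
  ∑-*ˡ []       k f = ≡.sym (ℤ.*-zeroʳ k)
  ∑-*ˡ (x ∷ xs) k f = ≡.trans (cong (ℤ._+_ (k ℤ.* f x)) (∑-*ˡ xs k f)) (≡.sym (ℤ.*-distribˡ-+ k (f x) (∑ xs f)))

  ∑-++ : ∀ (xs ys : List A) f → ∑ (xs ++ ys) f ≡ ∑ xs f ℤ.+ ∑ ys f
  ∑-++ []       ys f = ≡.sym (ℤ.+-identityˡ _)
  ∑-++ (x ∷ xs) ys f = ≡.trans (cong (ℤ._+_ (f x)) (∑-++ xs ys f)) (≡.sym (ℤ.+-assoc (f x) _ _))

  ∑-filter : ∀ {p} {P : A → Set p} (P? : ∀ x → Dec (P x)) xs f → ∑ (filter P? xs) f ≡ ∑ xs (λ x → 𝟙 (P? x) ℤ.* f x)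
  ∑-filter P? []       f = ≡.refl
  ∑-filter P? (x ∷ xs) f with P? x
  ... | yes _ = cong₂ ℤ._+_ (≡.sym (ℤ.*-identityˡ (f x))) (∑-filter P? xs f)
  ... | no  _ = ≡.trans (∑-filter P? xs f) (≡.sym (ℤ.+-identityˡ _))

  ∑-partition : ∀ {p} {P : A → Set p} (P? : ∀ x → Dec (P x)) xs f →
                ∑ xs f ≡ ∑ xs (λ x → 𝟙 (P? x) ℤ.* f x) ℤ.+ ∑ xs (λ x → 𝟙 (¬? (P? x)) ℤ.* f x)
  ∑-partition P? xs f = ≡.trans (∑-cong xs (λ {x} _ → 𝟙-¬ (P? x) (f x)))
    (∑-+ xs (λ x → 𝟙 (P? x) ℤ.* f x) (λ x → 𝟙 (¬? (P? x)) ℤ.* f x))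

  ∑-single : ∀ {xs : List A} {f x} → Unique xs → x ∈ₗ xs → (∀ {y} → y ∈ₗ xs → y ≢ x → f y ≡ + 0) → ∑ xs f ≡ f x
  ∑-single {x ∷ xs} {f} (x∉ ∷ _) (here ≡.refl) z =
    ≡.trans (cong (ℤ._+_ (f x)) (∑-zero xs λ y∈ → z (there y∈) (All.lookup x∉ y∈ ∘ ≡.sym))) (ℤ.+-identityʳ (f x))
  ∑-single {y ∷ xs} (y∉ ∷ u) (there x∈) z =
    ≡.trans (cong₂ ℤ._+_ (z (here ≡.refl) (All.lookup y∉ x∈)) (∑-single u x∈ (z ∘ there))) (ℤ.+-identityˡ _)

  length-filter-∑ : ∀ {p} {P : A → Set p} (P? : ∀ x → Dec (P x)) xs →
                    + length (filter P? xs) ≡ ∑ xs (λ x → 𝟙 (P? x))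
  length-filter-∑ P? []       = ≡.refl
  length-filter-∑ P? (x ∷ xs) with P? x
  ... | yes _ = cong (λ s → + 1 ℤ.+ s) (length-filter-∑ P? xs)
  ... | no  _ = ≡.trans (length-filter-∑ P? xs) (≡.sym (ℤ.+-identityˡ _))

  lookup-injective : ∀ {xs : List A} → Unique xs → ∀ {i j} → List.lookup xs i ≡ List.lookup xs j → i ≡ j
  lookup-injective (_  ∷ _) {zero}  {zero}  _  = ≡.refl
  lookup-injective (x∉ ∷ _) {zero}  {suc j} eq = contradiction eq (All.lookup x∉ (∈-lookup j))
  lookup-injective (x∉ ∷ _) {suc i} {zero}  eq = contradiction (≡.sym eq) (All.lookup x∉ (∈-lookup i))
  lookup-injective (_  ∷ u) {suc i} {suc j} eq = cong suc (lookup-injective u eq)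

filter-filter : ∀ {a p q r} {A : Set a} {P : A → Set p} {Q : A → Set q} {R : A → Set r}
                (P? : ∀ x → Dec (P x)) (Q? : ∀ x → Dec (Q x)) (R? : ∀ x → Dec (R x)) →
                (∀ {x} → R x → P x × Q x) → (∀ {x} → P x → Q x → R x) →
                ∀ xs → filter R? xs ≡ filter Q? (filter P? xs)
filter-filter P? Q? R? R⇒ ⇒R []       = ≡.refl
filter-filter P? Q? R? R⇒ ⇒R (x ∷ xs) with P? x
... | no ¬p = ≡.trans (List.filter-reject R? (¬p ∘ proj₁ ∘ R⇒)) (filter-filter P? Q? R? R⇒ ⇒R xs)
... | yes p with Q? x
...   | no ¬q = ≡.trans (List.filter-reject R? (¬q ∘ proj₂ ∘ R⇒)) (filter-filter P? Q? R? R⇒ ⇒R xs)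
...   | yes q = ≡.trans (List.filter-accept R? (⇒R p q)) (cong (x ∷_) (filter-filter P? Q? R? R⇒ ⇒R xs))

*-swapˡ : ∀ x y z → x ℤ.* (y ℤ.* z) ≡ y ℤ.* (x ℤ.* z)
*-swapˡ = solve-∀

∑-swap : ∀ {a b} {A : Set a} {B : Set b} (xs : List A) (ys : List B) (f : A → B → ℤ) →
         ∑ xs (λ x → ∑ ys (f x)) ≡ ∑ ys (λ y → ∑ xs (λ x → f x y))
∑-swap []       ys f = ≡.sym (∑-zero ys (λ _ → ≡.refl))
∑-swap (x ∷ xs) ys f = ≡.trans (cong (ℤ._+_ (∑ ys (f x))) (∑-swap xs ys f)) (≡.sym (∑-+ ys (f x) _))

∑-map : ∀ {a b} {A : Set a} {B : Set b} (g : A → B) xs f → ∑ (map g xs) f ≡ ∑ xs (f ∘ g)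
∑-map g []       f = ≡.refl
∑-map g (x ∷ xs) f = cong (ℤ._+_ (f (g x))) (∑-map g xs f)

∑-cartesianProductWith : ∀ {a b c} {A : Set a} {B : Set b} {C : Set c} (h : A → B → C) xs ys f →
                         ∑ (cartesianProductWith h xs ys) f ≡ ∑ xs (λ x → ∑ ys (λ y → f (h x y)))
∑-cartesianProductWith h []       ys f = ≡.refl
∑-cartesianProductWith h (x ∷ xs) ys f =
  ≡.trans (∑-++ (map (h x) ys) _ f) (cong₂ ℤ._+_ (∑-map (h x) ys f) (∑-cartesianProductWith h xs ys f))

∑-upTo-∷ : ∀ n f → ∑ (upTo (suc n)) f ≡ f 0 ℤ.+ ∑ (upTo n) (f ∘ suc)
∑-upTo-∷ n f = cong (ℤ._+_ (f 0)) (≡.trans (cong (λ xs → ∑ xs f) (≡.sym (List.map-applyUpTo id suc n))) (∑-map suc (upTo n) f))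

∑-upTo-∷ʳ : ∀ n f → ∑ (upTo (suc n)) f ≡ ∑ (upTo n) f ℤ.+ f n
∑-upTo-∷ʳ n f = ≡.trans (cong (λ xs → ∑ xs f) (≡.sym (List.upTo-∷ʳ n)))
  (≡.trans (∑-++ (upTo n) _ f) (cong (ℤ._+_ (∑ (upTo n) f)) (ℤ.+-identityʳ (f n))))

-- Binomial sums and simplex numbers

binomialTerm : ℕ → (ℕ → ℤ) → ℕ → ℤ
binomialTerm N a k = + (N C k) ℤ.* a k

-- When `a k` is T^k applied to a fixed function, this is the expansion of (1 + T)^N, cut off after
-- k = d.
binomialSum : ℕ → (ℕ → ℤ) → ℕ → ℤ
binomialSum d a N = ∑ (upTo (suc d)) (binomialTerm N a)

binomialSum-zero : ∀ d a → binomialSum d a 0 ≡ a 0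
binomialSum-zero d a = ≡.trans (∑-upTo-∷ d (binomialTerm 0 a))
  (≡.trans (cong₂ ℤ._+_ (ℤ.*-identityˡ (a 0)) (∑-zero (upTo d) (λ _ → ≡.refl))) (ℤ.+-identityʳ (a 0)))

-- Pascal's rule; shifting `a` stands for one more application of T. The shifted sum has one term
-- too many, the one with `a (suc d)`, which the hypothesis removes.
binomialSum-suc : ∀ d a N → a (suc d) ≡ + 0 → binomialSum d a (suc N) ≡ binomialSum d a N ℤ.+ binomialSum d (a ∘ suc) N
binomialSum-suc d a N a≡0 = begin
  binomialSum d a (suc N)
    ≡⟨ ∑-upTo-∷ d (binomialTerm (suc N) a) ⟩
  first ℤ.+ ∑ (upTo d) (binomialTerm (suc N) a ∘ suc)
    ≡⟨ cong (ℤ._+_ first) (≡.trans (∑-cong (upTo d) (λ {k} _ → pascal k))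
         (∑-+ (upTo d) (binomialTerm N (a ∘ suc)) (binomialTerm N a ∘ suc))) ⟩
  first ℤ.+ (low ℤ.+ high)
    ≡⟨ rearrange first low high ⟩
  first ℤ.+ high ℤ.+ (low ℤ.+ + 0)
    ≡⟨ cong₂ ℤ._+_ (≡.sym (∑-upTo-∷ d (binomialTerm N a))) (cong (ℤ._+_ low) (≡.sym last≡0)) ⟩
  binomialSum d a N ℤ.+ (low ℤ.+ binomialTerm N (a ∘ suc) d)
    ≡⟨ cong (ℤ._+_ (binomialSum d a N)) (≡.sym (∑-upTo-∷ʳ d (binomialTerm N (a ∘ suc)))) ⟩
  binomialSum d a N ℤ.+ binomialSum d (a ∘ suc) N ∎
  where
  open ≡-Reasoning
  first low high : ℤ
  first = binomialTerm (suc N) a 0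
  low   = ∑ (upTo d) (binomialTerm N (a ∘ suc))
  high  = ∑ (upTo d) (binomialTerm N a ∘ suc)
  pascal : ∀ k → binomialTerm (suc N) a (suc k) ≡ binomialTerm N (a ∘ suc) k ℤ.+ binomialTerm N a (suc k)
  pascal k = ≡.trans (cong (λ c → + c ℤ.* a (suc k)) (≡.sym (nCk+nC[k+1]≡[n+1]C[k+1] N k)))
    (≡.trans (cong (λ c → c ℤ.* a (suc k)) (ℤ.pos-+ (N C k) (N C suc k)))
      (ℤ.*-distribʳ-+ (a (suc k)) (+ (N C k)) (+ (N C suc k))))
  rearrange : ∀ x y z → x ℤ.+ (y ℤ.+ z) ≡ x ℤ.+ z ℤ.+ (y ℤ.+ + 0)
  rearrange = solve-∀
  last≡0 : binomialTerm N (a ∘ suc) d ≡ + 0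
  last≡0 = ≡.trans (cong (ℤ._*_ (+ (N C d))) a≡0) (ℤ.*-zeroʳ (+ (N C d)))

-- The argument is N + 1 - k. For k ≤ N it is positive and the upper index becomes (N + 1 - k) + k -
-- 1 = N; for k > N it is at most 0, and both sides vanish.
α-binomial : ∀ k N → α k (+ suc (suc N) ℤ.- + suc k) ≡ N C k
α-binomial k N with k ℕ.≤? N
... | yes k≤N = ≡.trans (cong (α k) (≡.trans (ℤ.[1+m]⊖[1+n]≡m⊖n (suc N) k)
        (≡.trans (ℤ.⊖-≥ (ℕ.m≤n⇒m≤1+n k≤N)) (cong +_ (ℕ.+-∸-assoc 1 k≤N)))))
        (cong (_C k) (ℕ.m∸n+n≡m k≤N))
... | no  k≰N = ≡.trans (cong (α k) (≡.trans (ℤ.[1+m]⊖[1+n]≡m⊖n (suc N) k) (ℤ.⊖-≤ (ℕ.≰⇒> k≰N))))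
        (≡.trans (α-nonPos (k ℕ.∸ suc N)) (≡.sym (k>n⇒nCk≡0 (ℕ.≰⇒> k≰N))))
  where
  α-nonPos : ∀ j → α k (ℤ.- + j) ≡ 0
  α-nonPos zero    = ≡.refl
  α-nonPos (suc j) = ≡.refl

-- Enumeration of subsets and vectors

allSubsets-complete : ∀ {m} (S : Subset m) → S ∈ₗ allSubsets m
allSubsets-complete []            = here ≡.refl
allSubsets-complete (outside ∷ S) = ∈-++⁺ˡ (∈-map⁺ (outside ∷_) (allSubsets-complete S))
allSubsets-complete (inside  ∷ S) = ∈-++⁺ʳ _ (∈-map⁺ (inside ∷_) (allSubsets-complete S))

allSubsets-unique : ∀ m → Unique (allSubsets m)
allSubsets-unique zero    = [] ∷ []
allSubsets-unique (suc m) =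
  Unique.++⁺ (Unique.map⁺ Vec.∷-injectiveʳ (allSubsets-unique m))
             (Unique.map⁺ Vec.∷-injectiveʳ (allSubsets-unique m)) disjoint
  where
  disjoint : ∀ {S} → ¬ (S ∈ₗ map (outside ∷_) (allSubsets m) × S ∈ₗ map (inside ∷_) (allSubsets m))
  disjoint (p , q) with ∈-map⁻ (outside ∷_) p | ∈-map⁻ (inside ∷_) q
  ... | _ , _ , ≡.refl | _ , _ , ()

module _ {a} {A : Set a} where

  vecs : List A → ∀ n → List (Vec A n)
  vecs xs zero    = [] ∷ []
  vecs xs (suc n) = cartesianProductWith _∷_ xs (vecs xs n)

  vecs-unique : ∀ {xs} → Unique xs → ∀ n → Unique (vecs xs n)
  vecs-unique u zero    = [] ∷ []
  vecs-unique u (suc n) = Unique.cartesianProductWith⁺ _∷_ Vec.∷-injective u (vecs-unique u n)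

∈-vecs : ∀ {a} {A : Set a} {xs : List A} {n} (v : Vec A n) → (∀ i → Vec.lookup v i ∈ₗ xs) → v ∈ₗ vecs xs n
∈-vecs []      _  = here ≡.refl
∈-vecs (x ∷ v) x∈ = ∈-cartesianProductWith⁺ _∷_ (x∈ zero) (∈-vecs v (x∈ ∘ suc))

-- Affine independence

module OrderedFieldProperties {κ ℓ₁ ℓ₂} (K : OrderedField κ ℓ₁ ℓ₂) where

  open OrderedField K
  open CommutativeRing commutativeRing
    using (semiring; ring; +-commutativeMonoid; setoid; +-cong; +-congˡ; +-congʳ; *-congˡ; *-congʳ; -‿cong;
           +-identityʳ; +-identityˡ; +-comm; *-identityˡ; *-identityʳ; *-assoc; *-comm; zeroˡ; zeroʳ;
           distribˡ; distribʳ; reflexive; sym; trans)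
  open import Algebra.Properties.CommutativeMonoid.Sum +-commutativeMonoid using (sum; sum-remove; ∑-distrib-+)
  open import Algebra.Properties.Semiring.Sum semiring using (*-distribʳ-sum)
  open import Algebra.Properties.Ring ring using (-‿distribˡ-*; -‿distribʳ-*; -0#≈0#)
  open import Relation.Binary.Reasoning.Setoid setoid
  open Polytopes K

  ∈-hull-resp-≋ : ∀ {e m} {q : Fin m → Point e} {S x y} → x ≋ y → x U.∈ hull q S → y U.∈ hull q S
  ∈-hull-resp-≋ x≋y (w , w≥0 , w-off , w≈1 , x≋) = w , w≥0 , w-off , w≈1 , λ j → trans (sym (x≋y j)) (x≋ j)

  hull-cong : ∀ {e m} {q q′ : Fin m → Point e} {S} → (∀ i → q i ≋ q′ i) → hull q S U.⊆ hull q′ S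
  hull-cong q≋q′ (w , w≥0 , w-off , w≈1 , x≋) =
    w , w≥0 , w-off , w≈1 , λ j → trans (x≋ j) (sum-cong (λ i → *-congˡ (q≋q′ i j)))

  eliminate : ∀ {n} (l c u : Fin n → Carrier) x →
              sum (λ j → l j * - c j) * x + sum (λ j → l j * u j) ≈ sum (λ j → l j * (u j + - (c j * x)))
  eliminate l c u x = begin
    sum (λ j → l j * - c j) * x + sum (λ j → l j * u j)       ≈⟨ +-comm _ _ ⟩
    sum (λ j → l j * u j) + sum (λ j → l j * - c j) * x       ≈⟨ +-congˡ (*-distribʳ-sum x (λ j → l j * - c j)) ⟩
    sum (λ j → l j * u j) + sum (λ j → l j * - c j * x)       ≈⟨ ∑-distrib-+ (λ j → l j * u j) (λ j → l j * - c j * x) ⟨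
    sum (λ j → l j * u j + l j * - c j * x)
      ≈⟨ sum-cong (λ j → trans (+-congˡ (*-assoc _ _ _)) (sym (distribˡ (l j) _ _))) ⟩
    sum (λ j → l j * (u j + - c j * x))    
      ≈⟨ sum-cong (λ j → *-congˡ (+-congˡ (sym (-‿distribˡ-* (c j) x)))) ⟩
    sum (λ j → l j * (u j + - (c j * x)))                     ∎

  -- Gaussian elimination, one column at a time. A zero column is dropped; otherwise multiples of a
  -- pivot row clear the column in the other rows, and a dependence among the reduced rows lifts to
  -- one among all rows.
  more-rows-than-columns⇒dependent :
    ∀ {n r} → n ℕ.< r → (W : Fin r → Fin n → Carrier) →
    ∃ λ (l : Fin r → Carrier) → (∃[ i ] ¬ l i ≈ 0#) × (∀ j → sum (λ i → l i * W i j) ≈ 0#)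
  more-rows-than-columns⇒dependent {zero}  {suc r} _ W = (λ _ → 1#) , (zero , 0≉1 ∘ sym) , λ ()
  more-rows-than-columns⇒dependent {suc n} {suc r} (s≤s n<r) W with Fin.any? (λ i → ¬? (W i zero ≟ 0#))
  ... | no column≈0 with more-rows-than-columns⇒dependent (ℕ.m<n⇒m<1+n n<r) (λ i j → W i (suc j))
  ...   | l , l≉0 , eqs = l , l≉0 , λ where
      zero    → sum-≈0 (λ i → trans (*-congˡ (entry≈0 i)) (zeroʳ (l i)))
      (suc j) → eqs j
    where
    entry≈0 : ∀ i → W i zero ≈ 0#
    entry≈0 i with W i zero ≟ 0#
    ... | yes p = p
    ... | no ¬p = contradiction (i , ¬p) column≈0
  more-rows-than-columns⇒dependent {suc n} {suc r} (s≤s n<r) W | yes (i₀ , pivot≉0) with inverse _ pivot≉0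
  ... | y , pivot*y≈1 = l , l≉0 , eqs
    where
    c : Fin r → Carrier
    c j = W (punchIn i₀ j) zero * y
    rest = more-rows-than-columns⇒dependent n<r (λ j k → W (punchIn i₀ j) (suc k) + - (c j * W i₀ (suc k)))
    l′ = proj₁ rest
    -- The multiples of the pivot row subtracted from the other rows add up to this coefficient,
    -- which the pivot row receives in `l`.
    v : Carrier
    v = sum (λ j → l′ j * - c j)
    l : Fin (suc r) → Carrier
    l = insertAt l′ i₀ v
    l≉0 : ∃[ i ] ¬ l i ≈ 0#
    l≉0 with proj₁ (proj₂ rest)
    ... | j , l′j≉0 = punchIn i₀ j , λ p → l′j≉0 (trans (reflexive (≡.sym (insertAt-punchIn l′ i₀ v j))) p)
    expand : ∀ k → sum (λ i → l i * W i k) ≈ sum (λ j → l′ j * (W (punchIn i₀ j) k + - (c j * W i₀ k)))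
    expand k = begin
      sum (λ i → l i * W i k)
        ≈⟨ sum-remove {i = i₀} (λ i → l i * W i k) ⟩
      l i₀ * W i₀ k + sum (λ j → l (punchIn i₀ j) * W (punchIn i₀ j) k)
        ≡⟨ cong₂ _+_ (cong (_* W i₀ k) (insertAt-lookup l′ i₀ v)) ≡.refl ⟩
      v * W i₀ k + sum (λ j → l (punchIn i₀ j) * W (punchIn i₀ j) k)
        ≈⟨ +-congˡ (sum-cong (λ j → *-congʳ (reflexive (insertAt-punchIn l′ i₀ v j)))) ⟩
      v * W i₀ k + sum (λ j → l′ j * W (punchIn i₀ j) k)
        ≈⟨ eliminate l′ c (λ j → W (punchIn i₀ j) k) (W i₀ k) ⟩
      sum (λ j → l′ j * (W (punchIn i₀ j) k + - (c j * W i₀ k))) ∎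
    eqs : ∀ k → sum (λ i → l i * W i k) ≈ 0#
    eqs zero    = trans (expand zero) (sum-≈0 (λ j → trans (*-congˡ (≈⇒diff (cleared j))) (zeroʳ (l′ j))))
      where
      cleared : ∀ j → c j * W i₀ zero ≈ W (punchIn i₀ j) zero
      cleared j = trans (*-assoc _ _ _) (trans (*-congˡ (trans (*-comm _ _) pivot*y≈1)) (*-identityʳ _))
    eqs (suc k) = trans (expand (suc k)) (proj₂ (proj₂ rest) k)

  -- If r exceeded n, the r by n matrix of convex weights would have a dependence `l` among its
  -- rows. As each row sums to 1, `l` sums to 0, and it annihilates the points `q` too, against
  -- their independence.
  affinelyIndependent-≤ : ∀ {e r n} {q : Fin r → Point e} → AffinelyIndependent q →
                          (v : Fin n → Point e) → (∀ i → q i U.∈ conv v) → r ℕ.≤ n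
  affinelyIndependent-≤ {e} {r} {n} {q} indep v q∈ = ℕ.≮⇒≥ λ n<r →
    let l , (i , li≉0) , eqs = more-rows-than-columns⇒dependent n<r W in
    li≉0 (indep l
      (trans (sum-cong (λ i → sym (trans (*-congˡ (row-sum i)) (*-identityʳ (l i))))) (average≈0 l eqs (λ _ → 1#)))
      (λ j → trans (sum-cong (λ i → *-congˡ (trans (q≋ i j) (·-comm (W i) (λ k → v k j))))) (average≈0 l eqs (λ k → v k j)))
      i)
    where
    W : Fin r → Point n
    W i = proj₁ (q∈ i)
    q≋ : ∀ i → q i ≋ comb (W i) v
    q≋ i = proj₂ (proj₂ (proj₂ (proj₂ (q∈ i))))
    row-sum : ∀ i → (λ _ → 1#) · W i ≈ 1#
    row-sum i = trans (sum-cong (λ j → *-identityˡ (W i j))) (proj₁ (proj₂ (proj₂ (proj₂ (q∈ i)))))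
    average≈0 : ∀ l → (∀ j → comb l W j ≈ 0#) → ∀ (x : Point n) → sum (λ i → l i * (x · W i)) ≈ 0#
    average≈0 l eqs x = trans (sym (·-comb x l W)) (sum-≈0 (λ j → trans (*-congˡ (eqs j)) (zeroʳ (x j))))

  -- The counterpart of `slack` for weights of any total; it is applied to affine dependences, whose
  -- total is 0.
  weighted-slack : ∀ {e m} (q : Fin m → Point e) a β μ →
                   sum (λ i → μ i * (β + - (a · q i))) ≈ sum μ * β + - (a · comb μ q)
  weighted-slack q a β μ = begin
    sum (λ i → μ i * (β + - (a · q i)))
      ≈⟨ sum-cong (λ i → trans (distribˡ (μ i) β _) (+-congˡ (sym (-‿distribʳ-* (μ i) _)))) ⟩
    sum (λ i → μ i * β + - (μ i * (a · q i)))
      ≈⟨ ∑-distrib-+ (λ i → μ i * β) (λ i → - (μ i * (a · q i))) ⟩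
    sum (λ i → μ i * β) + sum (λ i → - (μ i * (a · q i)))
      ≈⟨ +-cong (sum-* μ β) (trans (sum-neg (λ i → μ i * (a · q i))) (-‿cong (sym (·-comb a μ q)))) ⟩
    sum μ * β + - (a · comb μ q) ∎

  -- The functional that vanishes on all points but the first isolates the first coefficient.
  affinelyIndependent-∷ : ∀ {e m} (q : Fin (suc m) → Point e) a β → ¬ β + - (a · q zero) ≈ 0# →
                          (∀ i → β + - (a · q (suc i)) ≈ 0#) → AffinelyIndependent (q ∘ suc) → AffinelyIndependent q
  affinelyIndependent-∷ q a β head≉0 tail≈0 indep μ sum≈0 comb≈0 = λ where
      zero    → μ₀≈0
      (suc i) → indep (μ ∘ suc) (drop-head μ₀≈0 sum≈0)
                  (λ j → drop-head (trans (*-congʳ μ₀≈0) (zeroˡ _)) (comb≈0 j)) i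
    where
    drop-head : ∀ {x y} → x ≈ 0# → x + y ≈ 0# → y ≈ 0#
    drop-head x≈0 x+y≈0 = trans (sym (+-identityˡ _)) (trans (+-congʳ (sym x≈0)) x+y≈0)
    total : sum (λ i → μ i * (β + - (a · q i))) ≈ 0#
    total = trans (weighted-slack q a β μ) (trans (+-cong (trans (*-congʳ sum≈0) (zeroˡ β))
      (trans (-‿cong (sum-≈0 (λ j → trans (*-congˡ (comb≈0 j)) (zeroʳ (a j))))) -0#≈0#)) (+-identityʳ 0#))
    μ₀≈0 : μ zero ≈ 0#
    μ₀≈0 = *-cancel-≈0 head≉0 (trans (*-comm _ _) (drop-head
      (sum-≈0 (λ i → trans (*-congˡ (tail≈0 i)) (zeroʳ (μ (suc i))))) (trans (+-comm _ _) total)))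

  affinelyIndependent-point : ∀ {e} (q : Fin 1 → Point e) → AffinelyIndependent q
  affinelyIndependent-point q μ sum≈0 _ zero = trans (sym (+-identityʳ _)) sum≈0

  *-monoʳ-+ : ∀ {M N x y} → M ≲ N → Sgn true x → Sgn true (M * x + y) → Sgn true (N * x + y)
  *-monoʳ-+ {M} {N} {x} {y} M≲N x>0 p q = p (≲-trans (+-monoˡ-≲ y (diff⁻ (≲-respʳ-≈ eq
    (*-nonNeg (diff⁺ M≲N) (sgn-weaken true x>0))))) q)
    where
    eq : (N + - M) * x ≈ N * x + - (M * x)
    eq = trans (distribʳ x N (- M)) (+-congˡ (sym (-‿distribˡ-* M x)))

  -- For a single index with positive `s i` the multiple (1 - t i) / s i gives the value 1, and a
  -- larger multiple keeps the value positive, so the maximum over these indices works.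
  dominating-multiple : ∀ n (s t : Fin n → Carrier) → ∃[ M ] (∀ i → Sgn true (s i) → Sgn true (M * s i + t i))
  dominating-multiple zero    s t = 0# , λ ()
  dominating-multiple (suc n) s t with dominating-multiple n (s ∘ suc) (t ∘ suc) | s zero ≲? 0#
  ... | M , M-ok | yes s₀≲0 = M , λ where
    zero    s₀>0 → contradiction s₀≲0 s₀>0
    (suc i) → M-ok i
  ... | M , M-ok | no s₀>0 with pos-inverse s₀>0
  ...   | k , _ , s₀k≈1 = combine (≲-total M N)
    where
    N : Carrier
    N = (1# + - t zero) * k
    N-ok : Sgn true (N * s zero + t zero)
    N-ok = sgn-resp true (sym (trans (+-congʳ (trans (*-assoc _ _ _)
      (trans (*-congˡ (trans (*-comm _ _) s₀k≈1)) (*-identityʳ _)))) (cancel-+- (t zero) 1#))) 1>0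
    combine : M ≲ N ⊎ N ≲ M → ∃[ L ] (∀ i → Sgn true (s i) → Sgn true (L * s i + t i))
    combine (inj₁ M≲N) = N , λ where
      zero    _    → N-ok
      (suc i) sᵢ>0 → *-monoʳ-+ M≲N sᵢ>0 (M-ok i sᵢ>0)
    combine (inj₂ N≲M) = M , λ where
      zero    s₀>0 → *-monoʳ-+ N≲M s₀>0 N-ok
      (suc i) sᵢ>0 → M-ok i sᵢ>0

-- Faces and apexes

module Faces {κ ℓ₁ ℓ₂} (K : OrderedField κ ℓ₁ ℓ₂) {e m} (p : Fin m → Polytopes.Point K e) where

  open import Data.Fin.Subset using (_∩_)
  open OrderedField K
  open CommutativeRing commutativeRing
    using (ring; +-commutativeMonoid; setoid; +-cong; +-congˡ; +-congʳ; *-congˡ; *-congʳ; -‿cong;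
           +-identityʳ; +-identityˡ; *-identityˡ; *-comm; zeroˡ; zeroʳ; distribˡ; refl; sym; trans)
  open import Algebra.Properties.CommutativeMonoid.Sum +-commutativeMonoid using (sum)
  open import Algebra.Properties.CommutativeSemigroup
    (CommutativeRing.+-commutativeSemigroup commutativeRing) using (interchange)
  open import Algebra.Properties.Ring ring using (-‿distribʳ-*; -0#≈0#; -‿+-comm)
  open import Relation.Binary.Reasoning.Setoid setoid
  open Polytopes K
  open OrderedFieldProperties K

  supports⁺ : ∀ {S T a β} → (∀ {i} → i ∈ T → slackOf p a β i ≈ 0#) →
              (∀ {i} → i ∈ S → i ∉ T → Sgn true (slackOf p a β i)) → T ⊆ S → Supports p S T a β
  supports⁺ {S} {T} zeros positives T⊆S i with i ∈? T | i ∈? S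
  ... | yes i∈T | _       = on i∈T (≲-reflexive (sym (zeros i∈T))) (neg-≲ (≲-reflexive (zeros i∈T)))
  ... | no  i∉T | yes i∈S = off i∈S i∉T (positives i∈S i∉T)
  ... | no  i∉T | no  i∉S = free i∉S i∉T

  side-positive : ∀ {S T i x} → Side p S T i x → i ∈ S → i ∉ T → Sgn true x
  side-positive (on i∈T _ _)   _   i∉T = contradiction i∈T i∉T
  side-positive (off _ _ x>0)  _   _   = x>0
  side-positive (free i∉S _)   i∈S _   = contradiction i∈S i∉S

  slackOf-combination : ∀ M a β b γ i → slackOf p (λ j → M * a j + b j) (M * β + γ) i ≈ M * slackOf p a β i + slackOf p b γ i
  slackOf-combination M a β b γ i = begin
    M * β + γ + - ((λ j → M * a j + b j) · p i)
      ≈⟨ +-congˡ (-‿cong (trans (·-+ (λ j → M * a j) b (p i)) (+-congʳ (·-scale M a (p i))))) ⟩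
    M * β + γ + - (M * (a · p i) + b · p i)
      ≈⟨ +-congˡ (-‿+-comm _ _) ⟨
    M * β + γ + (- (M * (a · p i)) + - (b · p i))
      ≈⟨ interchange _ _ _ _ ⟩
    (M * β + - (M * (a · p i))) + (γ + - (b · p i))
      ≈⟨ +-congʳ (trans (+-congˡ (-‿distribʳ-* M _)) (sym (distribˡ M β _))) ⟩
    M * slackOf p a β i + slackOf p b γ i ∎

  Face⊤ : Subset m → Set _
  Face⊤ = Face p ⊤

  -- The functional exposing `T` in the whole polytope exposes it in `S` as well.
  face-restrict : ∀ {S T} → Face⊤ T → T ⊆ S → Face p S T
  face-restrict F@(ne , _) T⊆S with face⇒supports p F
  ... | a , β , s = supports⇒face p ne T⊆S
    (a , β , supports⁺ (λ i∈T → side-≈0 p (s _) i∈T) (λ _ i∉T → side-positive (s _) ∈⊤ i∉T) T⊆S)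

  -- Adding a large multiple of a functional supporting S to one supporting T in S
  -- makes every generator outside S strictly slack.
  face-trans : ∀ {S T} → Face⊤ S → Face p S T → Face⊤ T
  face-trans {S} {T} F G@(ne , T⊆S , _) with face⇒supports p F | face⇒supports p G
  ... | a , β , s | b , γ , t with dominating-multiple m (slackOf p a β) (slackOf p b γ)
  ...   | M , M-ok = supports⇒face p ne ⊆⊤ (_ , _ , supports⁺ zeros (λ _ → positives) ⊆⊤)
    where
    on-S : ∀ {i} → i ∈ S → slackOf p (λ j → M * a j + b j) (M * β + γ) i ≈ slackOf p b γ i
    on-S i∈S = trans (slackOf-combination M a β b γ _)
      (trans (+-congʳ (trans (*-congˡ (side-≈0 p (s _) i∈S)) (zeroʳ M))) (+-identityˡ _))
    zeros : ∀ {i} → i ∈ T → slackOf p (λ j → M * a j + b j) (M * β + γ) i ≈ 0#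
    zeros i∈T = trans (on-S (T⊆S i∈T)) (side-≈0 p (t _) i∈T)
    positives : ∀ {i} → i ∉ T → Sgn true (slackOf p (λ j → M * a j + b j) (M * β + γ) i)
    positives {i} i∉T with i ∈? S
    ... | yes i∈S = sgn-resp true (sym (on-S i∈S)) (side-positive (t _) i∈S i∉T)
    ... | no  i∉S = sgn-resp true (sym (slackOf-combination M a β b γ _)) (M-ok i (side-positive (s _) ∈⊤ i∉S))

  -- The sum of the two supporting functionals has slack 0 exactly where both slacks are 0. The
  -- common index `i` supplies the nonemptiness that `Face` demands.
  face-∩ : ∀ {F G i} → Face⊤ F → Face⊤ G → i ∈ F → i ∈ G → Face⊤ (F ∩ G)
  face-∩ {F} {G} FF FG i∈F i∈G with face⇒supports p FF | face⇒supports p FG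
  ... | a , β , s | b , γ , t =
    supports⇒face p (_ , x∈p∩q⁺ (i∈F , i∈G)) ⊆⊤ (_ , _ , supports⁺ zeros (λ _ → positives) ⊆⊤)
    where
    eq : ∀ j → slackOf p (λ j → 1# * a j + b j) (1# * β + γ) j ≈ slackOf p a β j + slackOf p b γ j
    eq j = trans (slackOf-combination 1# a β b γ j) (+-congʳ (*-identityˡ _))
    zeros : ∀ {j} → j ∈ F ∩ G → slackOf p (λ j → 1# * a j + b j) (1# * β + γ) j ≈ 0#
    zeros j∈ = trans (eq _) (trans (+-cong (side-≈0 p (s _) (p∩q⊆p F G j∈)) (side-≈0 p (t _) (p∩q⊆q F G j∈)))
                                   (+-identityʳ 0#))
    positives : ∀ {j} → j ∉ F ∩ G → Sgn true (slackOf p (λ j → 1# * a j + b j) (1# * β + γ) j)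
    positives {j} j∉ with j ∈? F
    ... | no  j∉F = sgn-resp true (sym (eq j)) (sgn-+ true false (side-positive (s j) ∈⊤ j∉F) (side-nonNeg p (t j) ∈⊤))
    ... | yes j∈F = sgn-resp true (sym (eq j))
      (sgn-+ false true (side-nonNeg p (s j) ∈⊤) (side-positive (t j) ∈⊤ λ j∈G → j∉ (x∈p∩q⁺ (j∈F , j∈G))))

  face-⊤ : Nonempty {m} ⊤ → Face⊤ ⊤
  face-⊤ ne = supports⇒face p ne ⊆⊤ ((λ _ → 0#) , 0# , supports⁺
    (λ {i} _ → trans (+-identityˡ _) (trans (-‿cong (sum-≈0 (λ j → zeroˡ (p i j)))) -0#≈0#))
    (λ _ i∉⊤ → contradiction ∈⊤ i∉⊤) ⊆⊤)

  face-saturated : ∀ {F i j} → Face⊤ F → i ∈ F → p j ≋ p i → j ∈ F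
  face-saturated (_ , _ , saturated , _) i∈F pj≋pi =
    saturated ∈⊤ (∈-hull-resp-≋ (λ k → sym (pj≋pi k)) (∈-hull p i∈F))

  _≋?_ : ∀ (x y : Point e) → Dec (x ≋ y)
  x ≋? y = Fin.all? λ k → x k ≟ y k

  -- Generators may coincide and faces are recorded by saturated index sets, so the record of a
  -- single point needs the indices of all its copies.
  pointFace : Fin m → Subset m
  pointFace i = Vec.tabulate λ j → does (p j ≋? p i)

  ∈-pointFace⁺ : ∀ {i j} → p j ≋ p i → j ∈ pointFace i
  ∈-pointFace⁺ {i} {j} eq = Vec.lookup⇒[]= j _ (≡.trans (Vec.lookup∘tabulate _ j) (dec-true (p j ≋? p i) eq))

  ∈-pointFace⁻ : ∀ {i j} → j ∈ pointFace i → p j ≋ p i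
  ∈-pointFace⁻ {i} {j} j∈ =
    does-true (p j ≋? p i) (≡.trans (≡.sym (Vec.lookup∘tabulate (λ j → does (p j ≋? p i)) j)) (Vec.[]=⇒lookup j∈))
    where
    does-true : ∀ {a} {A : Set a} (A? : Dec A) → does A? ≡ true → A
    does-true (yes a) _ = a

  i∈pointFace : ∀ i → i ∈ pointFace i
  i∈pointFace i = ∈-pointFace⁺ (λ _ → refl)

  pointFace-⊆ : ∀ {F i} → Face⊤ F → i ∈ F → pointFace i ⊆ F
  pointFace-⊆ FF i∈F j∈ = face-saturated FF i∈F (∈-pointFace⁻ j∈)

  pointFace-isPoint : ∀ i → IsPoint p (pointFace i)
  pointFace-isPoint i j j∈ k k∈ l = trans (∈-pointFace⁻ j∈ l) (sym (∈-pointFace⁻ k∈ l))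

  -- A functional exposing `p i` in `F` is strictly slack at the generators of `F` that are not
  -- copies of `p i`; `face-trans` then passes from `F` to the polytope.
  vertex⇒pointFace : ∀ {F i} → Face⊤ F → i ∈ F → IsVertexOf (p i) (hull p F) → Face⊤ (pointFace i)
  vertex⇒pointFace {F} {i} FF i∈F (a , β , valid , to , from) =
    face-trans FF (supports⇒face p (i , i∈pointFace i) (pointFace-⊆ FF i∈F) 
      (a , β , supports⁺ zeros positives (pointFace-⊆ FF i∈F)))
    where
    zeros : ∀ {j} → j ∈ pointFace i → slackOf p a β j ≈ 0#
    zeros j∈ = ≈⇒diff (proj₂ (to (∈-pointFace⁻ j∈)))
    positives : ∀ {j} → j ∈ F → j ∉ pointFace i → Sgn true (slackOf p a β j)
    positives j∈F j∉ r = j∉ (∈-pointFace⁺ (from (∈-hull p j∈F , diff≈0 (≲-antisym r (diff⁺ (valid (∈-hull p j∈F)))))))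

  pointFace⇒vertex : ∀ {i} → Face⊤ (pointFace i) → IsVertexOf (p i) (conv p)
  pointFace⇒vertex {i} (_ , _ , _ , a , β , valid , to , from) =
    a , β , valid ,
    (λ x≋ → to (∈-hull-resp-≋ (λ k → sym (x≋ k)) (∈-hull p (i∈pointFace i)))) ,
    (λ {x} xa → singleton (from xa))
    where
    singleton : ∀ {x} → x U.∈ hull p (pointFace i) → x ≋ p i
    singleton {x} (w , _ , w-off , w≈1 , x≋) k = begin
      x k                          ≈⟨ x≋ k ⟩
      sum (λ j → w j * p j k)      ≈⟨ sum-cong term ⟩
      sum (λ j → w j * p i k)      ≈⟨ sum-* w (p i k) ⟩
      sum w * p i k                ≈⟨ trans (*-congʳ w≈1) (*-identityˡ _) ⟩
      p i k                        ∎
      where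
      term : ∀ j → w j * p j k ≈ w j * p i k
      term j with j ∈? pointFace i
      ... | yes j∈ = *-congˡ (∈-pointFace⁻ j∈ k)
      ... | no  j∉ = trans (*-congʳ (w-off j j∉)) (trans (zeroˡ _) (sym (trans (*-congʳ (w-off j j∉)) (zeroˡ _))))

  -- The functional exposing `p i` has positive slack at every generator that is not a copy of
  -- `p i`. If no `p (f j)` were a copy, the average slack 0 would force all weights to be 0, but
  -- they sum to 1. This lets a simplex determine its vertices.
  vertex-∈-conv : ∀ {i n} (f : Fin n → Fin m) → Face⊤ (pointFace i) → p i U.∈ conv (p ∘ f) → ∃[ j ] p (f j) ≋ p i
  vertex-∈-conv {i} f FF (w , w≥0 , _ , w≈1 , pi≋) with face⇒supports p FF | Fin.any? (λ j → f j ∈? pointFace i)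
  ... | _         | yes (j , fj∈) = j , ∈-pointFace⁻ fj∈
  ... | a , β , s | no  none      = contradiction (trans (sym (sum-≈0 weights≈0)) w≈1) 0≉1
    where
    terms≈0 : ∀ j → w j * slackOf p a β (f j) ≈ 0#
    terms≈0 = sum≈0⇒≈0 (λ j → *-nonNeg (w≥0 j) (side-nonNeg p (s (f j)) ∈⊤))
      (trans (sym (slack (p ∘ f) a β w≈1 pi≋)) (side-≈0 p (s i) (i∈pointFace i)))
    weights≈0 : ∀ j → w j ≈ 0#
    weights≈0 j = *-cancel-≈0 (pos⇒≉0 (side-positive (s (f j)) ∈⊤ λ fj∈ → none (j , fj∈)))
      (trans (*-comm _ _) (terms≈0 j))

  module Apexes {c : Point e} (separates : Separates c (conv p)) (V : ApexSystem p c) where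

    open ApexSystem V

    apex-∈ : ∀ {F} → Face⊤ F → apex F ∈ F
    apex-∈ FF@(_ , _ , saturated , _) with isApex FF
    ... | (_ , _ , _ , to , _) , _ = saturated ∈⊤ (proj₁ (to (λ _ → refl)))

    apex-face : ∀ {F} → Face⊤ F → Face⊤ (pointFace (apex F))
    apex-face FF = vertex⇒pointFace FF (apex-∈ FF) (proj₁ (isApex FF))

    -- Each apex lies in the other face, so `c` takes the same value at both, and `c` separates
    -- vertices.
    apex-unique : ∀ {F G} → Face⊤ F → Face⊤ G → G ⊆ F → apex F ∈ G → p (apex F) ≋ p (apex G)
    apex-unique FF FG G⊆F aF∈G =
      separates _ _ (pointFace⇒vertex (apex-face FF)) (pointFace⇒vertex (apex-face FG))
        (≲-antisym (proj₂ (isApex FF) (∈-hull p (G⊆F (apex-∈ FG)))) (proj₂ (isApex FG) (∈-hull p aF∈G)))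

-- The recursion for polytope numbers

module Chains {κ ℓ₁ ℓ₂} (K : OrderedField κ ℓ₁ ℓ₂) {e m} (p : Fin m → Polytopes.Point K e)
              {c : Polytopes.Point K e} (separates : Polytopes.Separates K c (Polytopes.conv K p))
              (V : Polytopes.ApexSystem K p c) where

  open Polytopes K
  open Faces K p
  open Apexes separates V
  open ApexSystem V
  open CommutativeRing (OrderedField.commutativeRing K) using (sym)

  -- Opaque, so that the elimination procedure behind face? is never unfolded.
  opaque

    facesOf : Subset m → List (Subset m)
    facesOf S = faces p S

    facesOf≡faces : ∀ S → facesOf S ≡ faces p S
    facesOf≡faces S = ≡.refl

    face⁺ : ∀ {S F} → Face⊤ F → F ⊆ S → F ∈ₗ facesOf S
    face⁺ {S} {F} FF F⊆S = ∈-filter⁺ (face? p S) (allSubsets-complete F) (face-restrict FF F⊆S)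

    face⁻ : ∀ {S F} → Face⊤ S → F ∈ₗ facesOf S → Face⊤ F × F ⊆ S
    face⁻ {S} {F} FS F∈ with ∈-filter⁻ (face? p S) {v = F} {xs = allSubsets m} F∈
    ... | _ , FF@(_ , F⊆S , _) = face-trans FS FF , F⊆S

    𝓕⁻ : ∀ {F} → F ∈ₗ facesOf ⊤ → Face⊤ F
    𝓕⁻ {F} F∈ = proj₂ (∈-filter⁻ (face? p ⊤) {v = F} {xs = allSubsets m} F∈)

    facesOf-unique : ∀ S → Unique (facesOf S)
    facesOf-unique S = Unique.filter⁺ (face? p S) (allSubsets-unique m)

    facesOf-⊆ : ∀ {S} → Face⊤ S → facesOf S ≡ filter (λ F → F ⊆? S) (facesOf ⊤)
    facesOf-⊆ {S} FS = filter-filter (face? p ⊤) (λ F → F ⊆? S) (face? p S)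
      (λ {F} FF → face-trans FS FF , λ {i} → proj₁ (proj₂ FF) {i}) (λ FF F⊆S → face-restrict FF F⊆S) (allSubsets m)

  𝓕 : List (Subset m)
  𝓕 = facesOf ⊤

  𝓕⁺ : ∀ {F} → Face⊤ F → F ∈ₗ 𝓕
  𝓕⁺ FF = face⁺ FF ⊆⊤

  ∑-faces : ∀ {S} → Face⊤ S → ∀ f → ∑ (facesOf S) f ≡ ∑ 𝓕 (λ F → 𝟙 (F ⊆? S) ℤ.* f F)
  ∑-faces {S} FS f = ≡.trans (cong (λ xs → ∑ xs f) (facesOf-⊆ FS)) (∑-filter (λ F → F ⊆? S) 𝓕 f)

  -- One cone construction: a simplex with smallest face `G` is coned from the apex of `F`, and the
  -- cone has smallest face `F`. Quantifying minimality over the list `𝓕` keeps the relation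
  -- decidable.
  Step : Subset m → Subset m → Set
  Step F G = apex F ∉ G × G ⊆ F × All (λ H → apex F ∈ H → G ⊆ H → F ⊆ H) 𝓕

  step? : ∀ F G → Dec (Step F G)
  step? F G = ¬? (apex F ∈? G) ×-dec G ⊆? F ×-dec
    All.all? (λ H → apex F ∈? H →-dec (G ⊆? H →-dec F ⊆? H)) 𝓕

  -- Smallest faces containing a point and a face

  ⋂-face : ∀ {i : Fin m} (Hs : List (Subset m)) → (∀ {H} → H ∈ₗ Hs → Face⊤ H × i ∈ H) → Face⊤ (⋂ Hs) × i ∈ ⋂ Hs
  ⋂-face {i} []   _  = face-⊤ (i , ∈⊤) , ∈⊤
  ⋂-face (H ∷ Hs) ok with ok (here ≡.refl) | ⋂-face Hs (ok ∘ there)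
  ... | FH , i∈H | FI , i∈I = face-∩ FH FI i∈H i∈I , x∈p∩q⁺ (i∈H , i∈I)

  ⋂-lower : ∀ {H : Subset m} {Hs} → H ∈ₗ Hs → ⋂ Hs ⊆ H
  ⋂-lower {Hs = H ∷ Hs} (here ≡.refl) i∈ = p∩q⊆p H (⋂ Hs) i∈
  ⋂-lower {Hs = H ∷ Hs} (there H∈)    i∈ = ⋂-lower H∈ (p∩q⊆q H (⋂ Hs) i∈)

  ⋂-greatest : ∀ {G : Subset m} Hs → (∀ {H} → H ∈ₗ Hs → G ⊆ H) → G ⊆ ⋂ Hs
  ⋂-greatest []       _   _  = ∈⊤
  ⋂-greatest (H ∷ Hs) G⊆H i∈ = x∈p∩q⁺ (G⊆H (here ≡.refl) i∈ , ⋂-greatest Hs (G⊆H ∘ there) i∈)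

  joinable? : ∀ (i : Fin m) G H → Dec (i ∈ H × G ⊆ H)
  joinable? i G H = i ∈? H ×-dec G ⊆? H

  join : Fin m → Subset m → Subset m
  join i G = ⋂ (filter (joinable? i G) 𝓕)

  -- Every face in the list contains `i`, so no partial intersection is empty and `face-∩` applies
  -- throughout.
  join-face : ∀ i G → Face⊤ (join i G) × i ∈ join i G
  join-face i G = ⋂-face (filter (joinable? i G) 𝓕) λ H∈ →
    let H∈𝓕 , i∈H , _ = ∈-filter⁻ (joinable? i G) {xs = 𝓕} H∈ in 𝓕⁻ H∈𝓕 , i∈H

  join-upper : ∀ i G → G ⊆ join i G
  join-upper i G = ⋂-greatest (filter (joinable? i G) 𝓕) λ H∈ → proj₂ (proj₂ (∈-filter⁻ (joinable? i G) {xs = 𝓕} H∈))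

  join-least : ∀ {i G H} → Face⊤ H → i ∈ H → G ⊆ H → join i G ⊆ H
  join-least {i} {G} FH i∈H G⊆H = ⋂-lower (∈-filter⁺ (joinable? i G) (𝓕⁺ FH) (i∈H , λ {j} → G⊆H {j}))

  module _ {S G} (FS : Face⊤ S) (FG : Face⊤ G) (G⊆S : G ⊆ S) where

    private
      J : Subset m
      J = join (apex S) G
      FJ : Face⊤ J
      FJ = proj₁ (join-face (apex S) G)

    join-⊆ : J ⊆ S
    join-⊆ = join-least FS (apex-∈ FS) G⊆S

    apex-join : p (apex S) ≋ p (apex J)
    apex-join = apex-unique FS FJ join-⊆ (proj₂ (join-face (apex S) G))

    join-step : apex S ∉ G → Step J G
    join-step aS∉G =
      (λ aJ∈G → aS∉G (face-saturated FG aJ∈G apex-join)) , join-upper (apex S) G ,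
      All.tabulate λ H∈ aJ∈H G⊆H → join-least (𝓕⁻ H∈) (face-saturated (𝓕⁻ H∈) aJ∈H apex-join) G⊆H

    -- A face of `S` containing the apex of `S` has that point as its own apex. Hence the minimality
    -- in `Step F G` applies to `J`, and the minimality of `J` gives the other inclusion.
    step-unique : ∀ {F} → Face⊤ F → F ⊆ S → apex S ∈ F → Step F G → F ≡ J
    step-unique FF F⊆S aS∈F (_ , G⊆F , least) = ⊆-antisym
      (All.lookup least (𝓕⁺ FJ) (face-saturated FJ (proj₂ (join-face (apex S) G)) (λ j → sym (apex-unique FS FF F⊆S aS∈F j)))
        (join-upper (apex S) G))
      (join-least FF aS∈F G⊆F)

  -- The operator T on functions of faces, written as a matrix with entries 0 and 1.
  extend : (Subset m → ℤ) → Subset m → ℤ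
  extend f F = ∑ 𝓕 (λ G → 𝟙 (step? F G) ℤ.* f G)

  -- A step from `F` leads only to faces inside `F`, hence inside `S`; the other terms are 0. Once
  -- both sums run over the faces of `S`, they can be exchanged.
  extend-faces : ∀ {S F} f → Face⊤ S → F ⊆ S → extend f F ≡ ∑ (facesOf S) (λ G → 𝟙 (step? F G) ℤ.* f G)
  extend-faces {S} {F} f FS F⊆S = ≡.trans (∑-cong 𝓕 (λ {G} _ → term G)) (≡.sym (∑-faces FS _))
    where
    term : ∀ G → 𝟙 (step? F G) ℤ.* f G ≡ 𝟙 (G ⊆? S) ℤ.* (𝟙 (step? F G) ℤ.* f G)
    term G = ≡.sym (≡.trans (*-swapˡ (𝟙 (G ⊆? S)) (𝟙 (step? F G)) (f G)) (𝟙-*-cong (step? F G)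
      λ (_ , G⊆F , _) → ≡.trans (cong (λ x → x ℤ.* f G) (𝟙-yes (G ⊆? S) (λ {i} i∈G → F⊆S (G⊆F {i} i∈G))))
        (ℤ.*-identityˡ (f G))))

  apexSum restSum : Subset m → (Subset m → ℤ) → ℤ
  apexSum S f = ∑ (facesOf S) (λ F → 𝟙 (apex S ∈? F) ℤ.* f F)
  restSum S f = ∑ (facesOf S) (λ F → 𝟙 (¬? (apex S ∈? F)) ℤ.* f F)

  -- If `G` contains the apex of `S`, that point is the apex of every `F` containing it, and
  -- `Step F G` fails. Otherwise the join of the apex with `G` is the only face counted.
  join-count : ∀ {S} → Face⊤ S → ∀ {G} → G ∈ₗ facesOf S →
               ∑ (facesOf S) (λ F → 𝟙 (apex S ∈? F) ℤ.* 𝟙 (step? F G)) ≡ 𝟙 (¬? (apex S ∈? G))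
  join-count {S} FS {G} G∈ with face⁻ FS G∈ | apex S ∈? G
  ... | FG , G⊆S | yes aS∈G = ∑-zero (facesOf S) λ {F} F∈ → let FF , F⊆S = face⁻ FS F∈ in
    ≡.trans (𝟙-*-cong (apex S ∈? F) λ aS∈F → 𝟙-no (step? F G) λ (aF∉G , _) →
      aF∉G (face-saturated FG aS∈G (λ j → sym (apex-unique FS FF F⊆S aS∈F j))))
      (ℤ.*-zeroʳ (𝟙 (apex S ∈? F)))
  ... | FG , G⊆S | no aS∉G = ≡.trans
    (∑-single (facesOf-unique S) (face⁺ (proj₁ (join-face (apex S) G)) (join-⊆ FS FG G⊆S)) others)
    (cong₂ ℤ._*_ (𝟙-yes (apex S ∈? join (apex S) G) (proj₂ (join-face (apex S) G)))
                 (𝟙-yes (step? (join (apex S) G) G) (join-step FS FG G⊆S aS∉G)))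
    where
    others : ∀ {F} → F ∈ₗ facesOf S → F ≢ join (apex S) G → 𝟙 (apex S ∈? F) ℤ.* 𝟙 (step? F G) ≡ + 0
    others {F} F∈ F≢J = let FF , F⊆S = face⁻ FS F∈ in
      ≡.trans (𝟙-*-cong (apex S ∈? F) λ aS∈F → 𝟙-no (step? F G) λ s → F≢J (step-unique FS FG G⊆S FF F⊆S aS∈F s))
        (ℤ.*-zeroʳ (𝟙 (apex S ∈? F)))

  -- After exchanging the sums, the coefficient of `f G` is the number that `join-count` evaluates.
  -- This is what makes the powers of 1 + T obey the recursion.
  apexSum-extend : ∀ {S} → Face⊤ S → ∀ f → apexSum S (extend f) ≡ restSum S f
  apexSum-extend {S} FS f = begin
    ∑ (facesOf S) (λ F → 𝟙 (apex S ∈? F) ℤ.* extend f F)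
      ≡⟨ ∑-cong (facesOf S) (λ {F} F∈ → ≡.trans (cong (ℤ._*_ (𝟙 (apex S ∈? F))) (extend-faces f FS (proj₂ (face⁻ FS F∈))))
           (≡.sym (∑-*ˡ (facesOf S) (𝟙 (apex S ∈? F)) (λ G → 𝟙 (step? F G) ℤ.* f G)))) ⟩
    ∑ (facesOf S) (λ F → ∑ (facesOf S) (term F))
      ≡⟨ ∑-swap (facesOf S) (facesOf S) term ⟩
    ∑ (facesOf S) (λ G → ∑ (facesOf S) (λ F → term F G))
      ≡⟨ ∑-cong (facesOf S) column ⟩
    ∑ (facesOf S) (λ G → 𝟙 (¬? (apex S ∈? G)) ℤ.* f G) ∎
    where
    open ≡-Reasoning
    term : Subset m → Subset m → ℤ
    term F G = 𝟙 (apex S ∈? F) ℤ.* (𝟙 (step? F G) ℤ.* f G)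
    rotate : ∀ x y z → x ℤ.* (y ℤ.* z) ≡ z ℤ.* (x ℤ.* y)
    rotate = solve-∀
    column : ∀ {G} → G ∈ₗ facesOf S → ∑ (facesOf S) (λ F → term F G) ≡ 𝟙 (¬? (apex S ∈? G)) ℤ.* f G
    column {G} G∈ = begin
      ∑ (facesOf S) (λ F → term F G)
        ≡⟨ ∑-cong (facesOf S) (λ {F} _ → rotate (𝟙 (apex S ∈? F)) (𝟙 (step? F G)) (f G)) ⟩
      ∑ (facesOf S) (λ F → f G ℤ.* (𝟙 (apex S ∈? F) ℤ.* 𝟙 (step? F G)))
        ≡⟨ ∑-*ˡ (facesOf S) (f G) (λ F → 𝟙 (apex S ∈? F) ℤ.* 𝟙 (step? F G)) ⟩
      f G ℤ.* ∑ (facesOf S) (λ F → 𝟙 (apex S ∈? F) ℤ.* 𝟙 (step? F G))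
        ≡⟨ cong (ℤ._*_ (f G)) (join-count FS G∈) ⟩
      f G ℤ.* 𝟙 (¬? (apex S ∈? G))
        ≡⟨ ℤ.*-comm (f G) (𝟙 (¬? (apex S ∈? G))) ⟩
      𝟙 (¬? (apex S ∈? G)) ℤ.* f G ∎

  -- (1 + T)^N applied to the indicator of the vertices; its value at a face is the interior number
  -- at n = N + 2.
  interiorCount : ℕ → Subset m → ℤ
  interiorCount zero    F = 𝟙 (isPoint? p F)
  interiorCount (suc N) F = interiorCount N F ℤ.+ extend (interiorCount N) F

  totalCount : ℕ → Subset m → ℤ
  totalCount N S = ∑ (facesOf S) (interiorCount N)

  ∑-split : ∀ S f → ∑ (facesOf S) f ≡ apexSum S f ℤ.+ restSum S f
  ∑-split S f = ∑-partition (λ F → apex S ∈? F) (facesOf S) f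

  apexSum-+ : ∀ S f g → apexSum S (λ F → f F ℤ.+ g F) ≡ apexSum S f ℤ.+ apexSum S g
  apexSum-+ S f g = ≡.trans
    (∑-cong (facesOf S) (λ {F} _ → ℤ.*-distribˡ-+ (𝟙 (apex S ∈? F)) (f F) (g F)))
    (∑-+ (facesOf S) (λ F → 𝟙 (apex S ∈? F) ℤ.* f F) (λ F → 𝟙 (apex S ∈? F) ℤ.* g F))

  -- Over the faces containing the apex, the summand added by T gives the sum of `interiorCount N`
  -- over the faces avoiding it, which completes `totalCount N S`. The faces avoiding the apex form
  -- the increment.
  totalCount-suc : ∀ {S} → Face⊤ S → ∀ N → totalCount (suc N) S ≡ totalCount N S ℤ.+ restSum S (interiorCount (suc N))
  totalCount-suc {S} FS N = begin
    totalCount (suc N) S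
      ≡⟨ ∑-split S (interiorCount (suc N)) ⟩
    apexSum S (interiorCount (suc N)) ℤ.+ restSum S (interiorCount (suc N))
      ≡⟨ cong (λ x → x ℤ.+ restSum S (interiorCount (suc N)))
           (≡.trans (apexSum-+ S (interiorCount N) (extend (interiorCount N)))
             (cong (ℤ._+_ (apexSum S (interiorCount N))) (apexSum-extend FS (interiorCount N)))) ⟩
    apexSum S (interiorCount N) ℤ.+ restSum S (interiorCount N) ℤ.+ restSum S (interiorCount (suc N))
      ≡⟨ cong (λ x → x ℤ.+ restSum S (interiorCount (suc N))) (∑-split S (interiorCount N)) ⟨
    totalCount N S ℤ.+ restSum S (interiorCount (suc N)) ∎
    where open ≡-Reasoning

  -- Among the faces containing the apex only the apex itself is a point; it contributes the 1,
  -- which matches P(1).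
  totalCount-zero : ∀ {S} → Face⊤ S → totalCount 0 S ≡ + 1 ℤ.+ restSum S (interiorCount 0)
  totalCount-zero {S} FS = ≡.trans (∑-split S (interiorCount 0)) (cong (λ x → x ℤ.+ restSum S (interiorCount 0))
    (≡.trans (∑-single (facesOf-unique S) (face⁺ (apex-face FS) v⊆S) others)
      (cong₂ ℤ._*_ (𝟙-yes (apex S ∈? v) (i∈pointFace (apex S))) (𝟙-yes (isPoint? p v) (pointFace-isPoint (apex S))))))
    where
    v : Subset m
    v = pointFace (apex S)
    v⊆S : v ⊆ S
    v⊆S = pointFace-⊆ FS (apex-∈ FS)
    others : ∀ {F} → F ∈ₗ facesOf S → F ≢ v → 𝟙 (apex S ∈? F) ℤ.* 𝟙 (isPoint? p F) ≡ + 0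
    others {F} F∈ F≢v = ≡.trans (𝟙-*-cong (apex S ∈? F) λ aS∈F → 𝟙-no (isPoint? p F) λ point → F≢v (⊆-antisym
        (λ {i} i∈F → ∈-pointFace⁺ (point i i∈F (apex S) aS∈F))
        (pointFace-⊆ (proj₁ (face⁻ FS F∈)) aS∈F)))
      (ℤ.*-zeroʳ (𝟙 (apex S ∈? F)))

  -- Every face inside a point contains its apex, so no step starts there and T contributes nothing.
  interiorCount-point : ∀ {F} → Face⊤ F → IsPoint p F → ∀ N → interiorCount N F ≡ + 1
  interiorCount-point {F} FF point zero    = 𝟙-yes (isPoint? p F) point
  interiorCount-point {F} FF point (suc N) = cong₂ ℤ._+_ (interiorCount-point FF point N)
    (∑-zero 𝓕 λ {G} G∈ → cong (λ x → x ℤ.* interiorCount N G) (𝟙-no (step? F G) λ (aF∉G , G⊆F , _) →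
      aF∉G (face-saturated (𝓕⁻ G∈) (apex-∈ (𝓕⁻ G∈)) (point _ (apex-∈ FF) _ (G⊆F (apex-∈ (𝓕⁻ G∈)))))))

  totalCount-point : ∀ {F} → Face⊤ F → IsPoint p F → ∀ N → totalCount N F ≡ + 1
  totalCount-point {F} FF point N = ≡.trans
    (∑-single {f = interiorCount N} (facesOf-unique F) (face⁺ FF id) λ G∈ G≢F → contradiction (G≡F (face⁻ FF G∈)) G≢F)
    (interiorCount-point FF point N)
    where
    G≡F : ∀ {G} → Face⊤ G × G ⊆ F → G ≡ F
    G≡F (FG , G⊆F) = ⊆-antisym G⊆F λ {i} i∈F →
      face-saturated FG (apex-∈ FG) (point i i∈F _ (G⊆F (apex-∈ FG)))

  -- Comparison with the defining recursion

  nonempty-∣∣ : ∀ {F : Subset m} {i} → i ∈ F → 1 ℕ.≤ ∣ F ∣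
  nonempty-∣∣ {F} {i} i∈F = ≡.subst (ℕ._≤ ∣ F ∣) (∣⁅x⁆∣≡1 i) (p⊆q⇒∣p∣≤∣q∣ λ j∈ → ≡.subst (_∈ F) (≡.sym (x∈⁅y⁆⇒x≡y i j∈)) i∈F)

  proper-∣∣ : ∀ {F S : Subset m} {b} → F ⊆ S → F ≢ S → ∣ S ∣ ℕ.≤ suc b → ∣ F ∣ ℕ.≤ b
  proper-∣∣ {F} {S} F⊆S F≢S ∣S∣≤ with Fin.any? (λ i → i ∈? S ×-dec ¬? (i ∈? F))
  ... | yes (i , i∈S , i∉F) = ℕ.≤-pred (ℕ.≤-trans (p⊂q⇒∣p∣<∣q∣ (F⊆S , i , i∈S , i∉F)) ∣S∣≤)
  ... | no  none = contradiction (⊆-antisym F⊆S S⊆F) F≢S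
    where
    S⊆F : S ⊆ F
    S⊆F {i} i∈S with i ∈? F
    ... | yes i∈F = i∈F
    ... | no  i∉F = contradiction (i , i∈S , i∉F) none

  filtered-faces : ∀ {q} {Q : Subset m → Set q} (Q? : ∀ F → Dec (Q F)) {S} → Face⊤ S → (f g : Subset m → ℤ) →
                   (∀ {F} → Face⊤ F → F ⊆ S → Q F → f F ≡ g F) →
                   ∑ (filter Q? (faces p S)) f ≡ ∑ (facesOf S) (λ F → 𝟙 (Q? F) ℤ.* g F)
  filtered-faces Q? {S} FS f g f≗g = begin
    ∑ (filter Q? (faces p S)) f                   ≡⟨ cong (λ xs → ∑ (filter Q? xs) f) (facesOf≡faces S) ⟨
    ∑ (filter Q? (facesOf S)) f                   ≡⟨ ∑-filter Q? (facesOf S) f ⟩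
    ∑ (facesOf S) (λ F → 𝟙 (Q? F) ℤ.* f F)
      ≡⟨ ∑-cong (facesOf S) (λ {F} F∈ → 𝟙-*-cong (Q? F) {f F} {g F} (let FF , F⊆S = face⁻ FS F∈ in f≗g FF F⊆S)) ⟩
    ∑ (facesOf S) (λ F → 𝟙 (Q? F) ℤ.* g F)        ∎
    where open ≡-Reasoning

  _≡?_ : (F S : Subset m) → Dec (F ≡ S)
  _≡?_ = Vec.≡-dec Bool._≟_

  properSum : Subset m → (Subset m → ℤ) → ℤ
  properSum S f = ∑ (facesOf S) (λ F → 𝟙 (¬? (F ≡? S)) ℤ.* f F)

  totalCount-proper : ∀ {S} → Face⊤ S → ∀ N → totalCount N S ≡ interiorCount N S ℤ.+ properSum S (interiorCount N)
  totalCount-proper {S} FS N = ≡.trans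
    (∑-partition (λ F → F ≡? S) (facesOf S) (interiorCount N))
    (cong (λ x → x ℤ.+ properSum S (interiorCount N)) (≡.trans
      (∑-single {f = λ F → 𝟙 (F ≡? S) ℤ.* interiorCount N F} (facesOf-unique S) (face⁺ FS id)
        (λ {F} _ F≢S → cong (λ x → x ℤ.* interiorCount N F) (𝟙-no (F ≡? S) F≢S)))
      (≡.trans (cong (λ x → x ℤ.* interiorCount N S) (𝟙-yes (S ≡? S) ≡.refl)) (ℤ.*-identityˡ (interiorCount N S)))))

  -- The three statements are proved together along the defining recursion: an interior number
  -- refers to the number with the same bound `b` and to interior numbers of proper faces, whose
  -- fewer generators allow a smaller bound.
  interior≡interiorCount : ∀ b {S} → Face⊤ S → ∣ S ∣ ℕ.≤ b → (point? : Dec (IsPoint p S)) → ∀ N →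
                           interior p V b S point? (suc (suc N)) ≡ interiorCount N S
  number≡totalCount : ∀ b {S} → Face⊤ S → ∣ S ∣ ℕ.≤ b → (point? : Dec (IsPoint p S)) → ∀ N →
                      number p V b S point? (suc (suc N)) ≡ totalCount N S
  avoiding-apex≡restSum : ∀ b {S} → Face⊤ S → ∣ S ∣ ℕ.≤ suc b → ∀ N →
                          ∑ (filter (λ F → ¬? (apex S ∈? F)) (faces p S)) (λ F → interior p V b F (isPoint? p F) (suc (suc N)))
                            ≡ restSum S (interiorCount N)

  interior≡interiorCount zero    FS ∣S∣≤0 _ N = contradiction (ℕ.≤-trans (nonempty-∣∣ (apex-∈ FS)) ∣S∣≤0) λ ()
  interior≡interiorCount (suc b) FS ∣S∣≤ (yes point) N = ≡.sym (interiorCount-point FS point N)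
  interior≡interiorCount (suc b) {S} FS ∣S∣≤ (no ¬point) N = begin
    number p V (suc b) S (no ¬point) (suc (suc N)) ℤ.- removed
      ≡⟨ cong (λ x → x ℤ.- removed) (≡.trans (number≡totalCount (suc b) FS ∣S∣≤ (no ¬point) N) (totalCount-proper FS N)) ⟩
    interiorCount N S ℤ.+ others ℤ.- removed
      ≡⟨ cong (λ x → interiorCount N S ℤ.+ others ℤ.- x)
           (filtered-faces (λ F → ¬? (F ≡? S)) FS (λ F → interior p V b F (isPoint? p F) (suc (suc N))) (interiorCount N)
             (λ FF F⊆S F≢S → interior≡interiorCount b FF (proper-∣∣ {S = S} F⊆S F≢S ∣S∣≤) (isPoint? p _) N)) ⟩
    interiorCount N S ℤ.+ others ℤ.- others
      ≡⟨ cancel (interiorCount N S) others ⟩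
    interiorCount N S ∎
    where
    open ≡-Reasoning
    removed others : ℤ
    removed = ∑ (filter (λ F → ¬? (F ≡? S)) (faces p S)) (λ F → interior p V b F (isPoint? p F) (suc (suc N)))
    others  = properSum S (interiorCount N)
    cancel : ∀ x y → x ℤ.+ y ℤ.- y ≡ x
    cancel = solve-∀

  number≡totalCount zero    FS ∣S∣≤0 _ N = contradiction (ℕ.≤-trans (nonempty-∣∣ (apex-∈ FS)) ∣S∣≤0) λ ()
  number≡totalCount (suc b) FS ∣S∣≤ (yes point) N = ≡.sym (totalCount-point FS point N)
  -- The case n = 2, where P(n - 1) = 1 comes from the definition and not from the induction.
  number≡totalCount (suc b) FS ∣S∣≤ (no ¬point) zero =
    ≡.trans (cong (ℤ._+_ (+ 1)) (avoiding-apex≡restSum b FS ∣S∣≤ 0)) (≡.sym (totalCount-zero FS))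
  number≡totalCount (suc b) FS ∣S∣≤ (no ¬point) (suc N) =
    ≡.trans (cong₂ ℤ._+_ (number≡totalCount (suc b) FS ∣S∣≤ (no ¬point) N) (avoiding-apex≡restSum b FS ∣S∣≤ (suc N)))
      (≡.sym (totalCount-suc FS N))

  avoiding-apex≡restSum b {S} FS ∣S∣≤ N =
    filtered-faces (λ F → ¬? (apex S ∈? F)) FS (λ F → interior p V b F (isPoint? p F) (suc (suc N))) (interiorCount N)
      (λ {F} FF F⊆S aS∉F → interior≡interiorCount b FF
        (proper-∣∣ F⊆S (λ { ≡.refl → aS∉F (apex-∈ FS) }) ∣S∣≤) (isPoint? p _) N)

-- Counting simplexes

module _ {κ ℓ₁ ℓ₂} (K : OrderedField κ ℓ₁ ℓ₂) where

  open Polytopes K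

  -- Matching each set of one enumeration with an equal set of the other gives injections both ways,
  -- since neither enumeration repeats a set.
  HasSize-unique : ∀ {e ℓ′ a n} {𝒳 : U.Pred (U.Pred (Point e) _) ℓ′} {A : Set a} → HasSize 𝒳 n →
                   ∀ {xs : List A} (φ : A → U.Pred (Point e) _) → Unique xs →
                   (∀ {x} → x ∈ₗ xs → φ x U.∈ 𝒳) →
                   (∀ {x y} → x ∈ₗ xs → y ∈ₗ xs → φ x U.≐ φ y → x ≡ y) →
                   (∀ {Y} → Y U.∈ 𝒳 → ∃[ x ] x ∈ₗ xs × Y U.≐ φ x) → n ≡ length xs
  HasSize-unique {n = n} (X , X∈ , X-injective , X-complete) {xs} φ xs! φ∈ φ-injective φ-complete =
    ℕ.≤-antisym (Fin.injective⇒≤ {f = f} f-injective) (Fin.injective⇒≤ {f = g} g-injective)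
    where
    f : Fin n → Fin (length xs)
    f i = Any.index (proj₁ (proj₂ (φ-complete (X∈ i))))
    lookup-f : ∀ i → List.lookup xs (f i) ≡ proj₁ (φ-complete (X∈ i))
    lookup-f i = ≡.sym (lookup-index (proj₁ (proj₂ (φ-complete (X∈ i)))))
    X≐φ : ∀ i → X i U.≐ φ (List.lookup xs (f i))
    X≐φ i = ≡.subst (λ x → X i U.≐ φ x) (≡.sym (lookup-f i)) (proj₂ (proj₂ (φ-complete (X∈ i))))
    f-injective : ∀ {i j} → f i ≡ f j → i ≡ j
    f-injective {i} {j} eq = X-injective i j
      (≐-trans (≡.subst (λ k → X i U.≐ φ (List.lookup xs k)) eq (X≐φ i)) (≐-sym (X≐φ j)))
    g : Fin (length xs) → Fin n
    g i = proj₁ (X-complete (φ∈ (∈-lookup i)))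
    φ≐X : ∀ i → φ (List.lookup xs i) U.≐ X (g i)
    φ≐X i = proj₂ (X-complete (φ∈ (∈-lookup i)))
    g-injective : ∀ {i j} → g i ≡ g j → i ≡ j
    g-injective {i} {j} eq = lookup-injective xs! (φ-injective (∈-lookup i) (∈-lookup j)
      (≐-trans (≡.subst (λ k → φ (List.lookup xs i) U.≐ X k) eq (φ≐X i)) (≐-sym (φ≐X j))))

module Simplexes {κ ℓ₁ ℓ₂} (K : OrderedField κ ℓ₁ ℓ₂) {e m} (p : Fin m → Polytopes.Point K e)
                 {c : Polytopes.Point K e} (separates : Polytopes.Separates K c (Polytopes.conv K p))
                 (V : Polytopes.ApexSystem K p c) where

  open Polytopes K
  open OrderedFieldProperties K
  open Faces K p
  open Apexes separates V
  open Chains K p separates V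
  open ApexSystem V
  open CommutativeRing (OrderedField.commutativeRing K) using (sym)

  -- Different chains of faces can have the same apexes. A canonical chain has the smallest
  -- possible faces, and its simplex determines it.
  Canonical : ∀ {k} → Vec (Subset m) (suc k) → Set (κ ⊔ ℓ₁ ⊔ ℓ₂)
  Canonical (F ∷ [])    = Face⊤ F × IsPoint p F
  Canonical (F ∷ G ∷ v) = Face⊤ F × Step F G × Canonical (G ∷ v)

  opaque

    canonical? : ∀ {k} (v : Vec (Subset m) (suc k)) → Dec (Canonical v)
    canonical? (F ∷ [])    = face? p ⊤ F ×-dec isPoint? p F
    canonical? (F ∷ G ∷ v) = face? p ⊤ F ×-dec step? F G ×-dec canonical? (G ∷ v)

  canonical-head : ∀ {k F} {v : Vec (Subset m) k} → Canonical (F ∷ v) → Face⊤ F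
  canonical-head {v = []}    (FF , _) = FF
  canonical-head {v = _ ∷ _} (FF , _) = FF

  canonical-faces : ∀ {k} (v : Vec (Subset m) (suc k)) → Canonical v → ∀ i → Face⊤ (Vec.lookup v i)
  canonical-faces (F ∷ v)     chain           zero    = canonical-head chain
  canonical-faces (F ∷ G ∷ v) (_ , _ , chain) (suc i) = canonical-faces (G ∷ v) chain i

  canonical-steps : ∀ {k} (v : Vec (Subset m) (suc k)) → Canonical v →
                    ∀ (i : Fin k) → Step (Vec.lookup v (inject₁ i)) (Vec.lookup v (suc i))
  canonical-steps (F ∷ G ∷ v) (_ , s , _) zero    = s
  canonical-steps (F ∷ G ∷ v) (_ , _ , chain) (suc i) = canonical-steps (G ∷ v) chain i

  apexes : ∀ {n} → Vec (Subset m) n → Fin n → Point e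
  apexes v i = p (apex (Vec.lookup v i))

  apexes-∈-head : ∀ {k F} (v : Vec (Subset m) k) → Canonical (F ∷ v) → ∀ i → apex (Vec.lookup (F ∷ v) i) ∈ F
  apexes-∈-head v       chain                         zero    = apex-∈ (canonical-head chain)
  apexes-∈-head (G ∷ v) (_ , (_ , G⊆F , _) , chain) (suc i) = G⊆F (apexes-∈-head v chain i)

  -- By induction `H` contains the next face, and the minimality in `Step` lifts this to `F`. So the
  -- head is determined by the apexes of the chain.
  canonical-head-least : ∀ {k F H} (v : Vec (Subset m) k) → Canonical (F ∷ v) → Face⊤ H →
                         (∀ i → apex (Vec.lookup (F ∷ v) i) ∈ H) → F ⊆ H
  canonical-head-least []      (FF , point) FH a∈H {i} i∈F = face-saturated FH (a∈H zero) (point i i∈F _ (apex-∈ FF))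
  canonical-head-least (G ∷ v) (_ , (_ , _ , least) , chain) FH a∈H =
    All.lookup least (𝓕⁺ FH) (a∈H zero) (canonical-head-least v chain FH (a∈H ∘ suc))

  -- The functional supporting the second face vanishes at all later apexes, which lie in that face,
  -- but not at the first apex.
  canonical-independent : ∀ {k} (v : Vec (Subset m) (suc k)) → Canonical v → AffinelyIndependent (apexes v)
  canonical-independent (F ∷ [])    chain = affinelyIndependent-point (apexes (F ∷ []))
  canonical-independent (F ∷ G ∷ v) (FF , (aF∉G , _) , chain) with face⇒supports p (canonical-head chain)
  ... | a , β , s = affinelyIndependent-∷ (apexes (F ∷ G ∷ v)) a β
    (pos⇒≉0 (side-positive (s _) ∈⊤ aF∉G))
    (λ i → side-≈0 p (s _) (apexes-∈-head v chain i))
    (canonical-independent (G ∷ v) chain)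

  ApexesAmong : ∀ {k l} → Vec (Subset m) k → Vec (Subset m) l → Set ℓ₁
  ApexesAmong v w = ∀ i → ∃[ j ] apexes v i ≋ apexes w j

  -- The heads agree because each is the smallest face containing the common apexes. The first apex
  -- avoids the second face, so it is none of the later apexes, and the tails again have the same
  -- apexes.
  canonical-injective : ∀ {k} (v w : Vec (Subset m) (suc k)) → Canonical v → Canonical w →
                        ApexesAmong v w → ApexesAmong w v → v ≡ w
  canonical-injective (F ∷ v) (H ∷ w) chain-v chain-w v⊆w w⊆v = go v w chain-v chain-w v⊆w w⊆v
    (⊆-antisym (least v w chain-v chain-w v⊆w) (least w v chain-w chain-v w⊆v))
    where
    least : ∀ {k F H} (v w : Vec (Subset m) k) → Canonical (F ∷ v) → Canonical (H ∷ w) →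
            ApexesAmong (F ∷ v) (H ∷ w) → F ⊆ H
    least v w chain-v chain-w v⊆w = canonical-head-least v chain-v (canonical-head chain-w) λ i →
      face-saturated (canonical-head chain-w) (apexes-∈-head w chain-w (proj₁ (v⊆w i))) (proj₂ (v⊆w i))
    tail-among : ∀ {k l F G} {v : Vec (Subset m) k} {w : Vec (Subset m) l} → Canonical (F ∷ G ∷ v) →
                 ApexesAmong (F ∷ G ∷ v) (F ∷ w) → ApexesAmong (G ∷ v) w
    tail-among {v = v} (_ , (aF∉G , _) , chain) v⊆w i with v⊆w (suc i)
    ... | zero  , eq = contradiction
      (face-saturated (canonical-head chain) (apexes-∈-head v chain i) (λ l → sym (eq l))) aF∉G
    ... | suc j , eq = j , eq
    go : ∀ {k} {F H : Subset m} (v w : Vec (Subset m) k) → Canonical (F ∷ v) → Canonical (H ∷ w) →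
         ApexesAmong (F ∷ v) (H ∷ w) → ApexesAmong (H ∷ w) (F ∷ v) → F ≡ H → F ∷ v ≡ H ∷ w
    go []      []      _ _ _ _ ≡.refl = ≡.refl
    go {F = F} (G ∷ v) (I ∷ w) chain-v@(_ , _ , chain-v′) chain-w@(_ , _ , chain-w′) v⊆w w⊆v ≡.refl =
      cong (F ∷_) (canonical-injective (G ∷ v) (I ∷ w) chain-v′ chain-w′ (tail-among chain-v v⊆w) (tail-among chain-w w⊆v))

  simplex : ∀ {n} → Vec (Subset m) n → U.Pred (Point e) _
  simplex v = conv (apexes v)

  simplex-⊆⇒among : ∀ {k l} (v : Vec (Subset m) (suc k)) (w : Vec (Subset m) l) → Canonical v →
                    simplex v U.⊆ simplex w → ApexesAmong v w
  simplex-⊆⇒among v w chain v⊆w i with vertex-∈-conv (λ j → apex (Vec.lookup w j))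
    (apex-face (canonical-faces v chain i)) (v⊆w (∈-hull (apexes v) ∈⊤))
  ... | j , eq = j , λ l → sym (eq l)

  simplex-injective : ∀ {k} {v w : Vec (Subset m) (suc k)} → Canonical v → Canonical w → simplex v U.≐ simplex w → v ≡ w
  simplex-injective {v = v} {w} chain-v chain-w (v⊆w , w⊆v) =
    canonical-injective v w chain-v chain-w (simplex-⊆⇒among v w chain-v v⊆w) (simplex-⊆⇒among w v chain-w w⊆v)

  simplex-∈-triangulation : ∀ {k d} (v : Vec (Subset m) (suc k)) → Canonical v → k ℕ.≤ d →
                            simplex v U.∈ Triangulation p V d U.∩ IsSimplex k
  simplex-∈-triangulation v chain k≤d =
    inj₂ (_ , k≤d , Vec.lookup v , canonical-faces v chain ,
      (λ i → let aF∉G , G⊆F , _ = canonical-steps v chain i in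
        G⊆F , apex (Vec.lookup v (inject₁ i)) , apex-∈ (canonical-faces v chain (inject₁ i)) , aF∉G) ,
      (λ i → proj₁ (canonical-steps v chain i)) , ≐-refl) ,
    (apexes v , canonical-independent v chain , ≐-refl)

  -- Built from the smallest face upwards: the last face shrinks to its apex, and each earlier one
  -- to the join of its apex with the face already built. The new faces lie inside the old ones, so
  -- apexes are still avoided and stay the same points.
  canonicalise : ∀ k (G : Fin (suc k) → Subset m) → (∀ i → Face⊤ (G i)) →
                 (∀ (i : Fin k) → G (suc i) ⊂ G (inject₁ i)) → (∀ (i : Fin k) → apex (G (inject₁ i)) ∉ G (suc i)) →
                 ∃[ F ] ∃ λ (v : Vec (Subset m) k) → Canonical (F ∷ v) × F ⊆ G zero × (∀ i → apexes (F ∷ v) i ≋ p (apex (G i)))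
  canonicalise zero G faces _ _ =
    pointFace (apex (G zero)) , [] , (apex-face (faces zero) , pointFace-isPoint _) ,
    pointFace-⊆ (faces zero) (apex-∈ (faces zero)) ,
    λ { zero → ∈-pointFace⁻ (apex-∈ (apex-face (faces zero))) }
  canonicalise (suc k) G faces decreasing avoiding
    with canonicalise k (G ∘ suc) (faces ∘ suc) (decreasing ∘ suc) (avoiding ∘ suc)
  ... | F , v , chain , F⊆G₁ , eqs =
    join (apex (G zero)) F , F ∷ v ,
    (proj₁ (join-face (apex (G zero)) F) ,
     join-step (faces zero) (canonical-head chain) F⊆G₀ (λ a∈F → avoiding zero (F⊆G₁ a∈F)) , chain) ,
    join-⊆ (faces zero) (canonical-head chain) F⊆G₀ ,
    λ where
      zero    l → sym (apex-join (faces zero) (canonical-head chain) F⊆G₀ l)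
      (suc i)   → eqs i
    where
    F⊆G₀ : F ⊆ G zero
    F⊆G₀ i∈F = proj₁ (decreasing zero) (F⊆G₁ i∈F)

  -- The length of the chain is not given to be k; comparing the two affinely independent families
  -- that span `Y` shows that it is.
  triangulation-complete : ∀ {k d Y} → Y U.∈ Triangulation p V d U.∩ IsSimplex k →
                           ∃ λ (v : Vec (Subset m) (suc k)) → Canonical v × Y U.≐ simplex v
  -- The empty set is no k-simplex, since a simplex contains its first vertex.
  triangulation-complete (inj₁ (Y⊆∅ , _) , q , _ , _ , conv⊆Y) = ⊥-elim (Y⊆∅ (conv⊆Y (∈-hull q (∈⊤ {x = zero}))))
  triangulation-complete {k} {Y = Y} (inj₂ (k′ , _ , G , faces , decreasing , avoiding , Y⊆ , ⊆Y) , q , q-independent , Y⊆q , q⊆Y)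
    with canonicalise k′ G faces decreasing avoiding
  ... | F , v , chain , _ , eqs = cast (ℕ.≤-antisym
          (ℕ.≤-pred (affinelyIndependent-≤ q-independent (apexes (F ∷ v)) (λ i → Y⊆simplex (q⊆Y (∈-hull q {i = i} ∈⊤)))))
          (ℕ.≤-pred (affinelyIndependent-≤ (canonical-independent (F ∷ v) chain) q
            (λ i → Y⊆q (simplex⊆Y (∈-hull (apexes (F ∷ v)) {i = i} ∈⊤))))))
    where
    Y⊆simplex : Y U.⊆ simplex (F ∷ v)
    Y⊆simplex y∈ = hull-cong (λ i l → sym (eqs i l)) (Y⊆ y∈)
    simplex⊆Y : simplex (F ∷ v) U.⊆ Y
    simplex⊆Y y∈ = ⊆Y (hull-cong eqs y∈)
    cast : k ≡ k′ → ∃ λ (v : Vec (Subset m) (suc k)) → Canonical v × Y U.≐ simplex v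
    cast ≡.refl = F ∷ v , chain , Y⊆simplex , simplex⊆Y

  -- Canonical chains counted by their smallest containing face

  canonicalChains : ∀ k → List (Vec (Subset m) (suc k))
  canonicalChains k = filter canonical? (vecs 𝓕 (suc k))

  canonicalChains⁻ : ∀ {k v} → v ∈ₗ canonicalChains k → Canonical v
  canonicalChains⁻ {k} v∈ = proj₂ (∈-filter⁻ canonical? {xs = vecs 𝓕 (suc k)} v∈)

  size≡length : ∀ {k d n} → k ℕ.≤ d → HasSize (Triangulation p V d U.∩ IsSimplex k) n → n ≡ length (canonicalChains k)
  size≡length {k} k≤d size = HasSize-unique K size simplex
    (Unique.filter⁺ canonical? (vecs-unique (facesOf-unique ⊤) (suc k)))
    (λ {v} v∈ → simplex-∈-triangulation v (canonicalChains⁻ v∈) k≤d)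
    (λ v∈ w∈ → simplex-injective (canonicalChains⁻ v∈) (canonicalChains⁻ w∈))
    (λ Y∈ → let v , chain , Y≐ = triangulation-complete Y∈ in
      v , ∈-filter⁺ canonical? (∈-vecs v (λ i → 𝓕⁺ (canonical-faces v chain i))) chain , Y≐)

  chainCount : ℕ → Subset m → ℤ
  chainCount k F = ∑ (vecs 𝓕 k) (λ v → 𝟙 (canonical? (F ∷ v)))

  chainCount-zero : ∀ {F} → Face⊤ F → chainCount 0 F ≡ 𝟙 (isPoint? p F)
  chainCount-zero {F} FF = ≡.trans (ℤ.+-identityʳ (𝟙 (canonical? (F ∷ []))))
    (𝟙-cong (canonical? (F ∷ [])) (isPoint? p F) proj₂ (FF ,_))

  -- Being canonical splits into a first step and a canonical tail, so the indicator factors. Hence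
  -- `chainCount k` is T^k applied to the indicator of the vertices.
  chainCount-suc : ∀ {F} → Face⊤ F → ∀ k → chainCount (suc k) F ≡ extend (chainCount k) F
  chainCount-suc {F} FF k = ≡.trans
    (∑-cartesianProductWith _∷_ 𝓕 (vecs 𝓕 k) (λ v → 𝟙 (canonical? (F ∷ v))))
    (∑-cong 𝓕 λ {G} _ → ≡.trans
      (∑-cong (vecs 𝓕 k) (λ {v} _ → ≡.trans
        (𝟙-cong (canonical? (F ∷ G ∷ v)) (step? F G ×-dec canonical? (G ∷ v)) proj₂ (FF ,_))
        (𝟙-× (step? F G) (canonical? (G ∷ v)))))
      (∑-*ˡ (vecs 𝓕 k) (𝟙 (step? F G)) (λ v → 𝟙 (canonical? (G ∷ v)))))

  length≡∑chainCount : ∀ k → + length (canonicalChains k) ≡ ∑ 𝓕 (chainCount k)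
  length≡∑chainCount k = ≡.trans (length-filter-∑ canonical? (vecs 𝓕 (suc k)))
    (∑-cartesianProductWith _∷_ 𝓕 (vecs 𝓕 k) (λ v → 𝟙 (canonical? v)))

  ∑-binomialSum : ∀ d (w : Subset m → ℤ) (a : Subset m → ℕ → ℤ) N →
                  ∑ 𝓕 (λ F → w F ℤ.* binomialSum d (a F) N) ≡ binomialSum d (λ k → ∑ 𝓕 (λ F → w F ℤ.* a F k)) N
  ∑-binomialSum d w a N = begin
    ∑ 𝓕 (λ F → w F ℤ.* binomialSum d (a F) N)
      ≡⟨ ∑-cong 𝓕 (λ {F} _ → ≡.sym (∑-*ˡ (upTo (suc d)) (w F) (binomialTerm N (a F)))) ⟩
    ∑ 𝓕 (λ F → ∑ (upTo (suc d)) (λ k → w F ℤ.* binomialTerm N (a F) k))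
      ≡⟨ ∑-swap 𝓕 (upTo (suc d)) (λ F k → w F ℤ.* binomialTerm N (a F) k) ⟩
    ∑ (upTo (suc d)) (λ k → ∑ 𝓕 (λ F → w F ℤ.* binomialTerm N (a F) k))
      ≡⟨ ∑-cong (upTo (suc d)) (λ {k} _ → ≡.trans
           (∑-cong 𝓕 (λ {F} _ → *-swapˡ (w F) (+ (N C k)) (a F k)))
           (∑-*ˡ 𝓕 (+ (N C k)) (λ F → w F ℤ.* a F k))) ⟩
    binomialSum d (λ k → ∑ 𝓕 (λ F → w F ℤ.* a F k)) N ∎
    where open ≡-Reasoning

  module _ {d} (no-longer : ∀ {F} → Face⊤ F → chainCount (suc d) F ≡ + 0) where

    -- Applying T term by term shifts `k` by one, and Pascal's rule recombines the two sums;
    -- `no-longer` removes the term beyond d.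
    interiorCount-binomial : ∀ N {F} → Face⊤ F → interiorCount N F ≡ binomialSum d (λ k → chainCount k F) N
    interiorCount-binomial zero    {F} FF = ≡.sym (≡.trans (binomialSum-zero d (λ k → chainCount k F)) (chainCount-zero FF))
    interiorCount-binomial (suc N) {F} FF = begin
      interiorCount N F ℤ.+ extend (interiorCount N) F
        ≡⟨ cong₂ ℤ._+_ (interiorCount-binomial N FF)
             (∑-cong 𝓕 (λ {G} G∈ → cong (ℤ._*_ (𝟙 (step? F G))) (interiorCount-binomial N (𝓕⁻ G∈)))) ⟩
      binomialSum d (λ k → chainCount k F) N ℤ.+ ∑ 𝓕 (λ G → 𝟙 (step? F G) ℤ.* binomialSum d (λ k → chainCount k G) N)
        ≡⟨ cong (ℤ._+_ (binomialSum d (λ k → chainCount k F) N)) (≡.trans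
             (∑-binomialSum d (λ G → 𝟙 (step? F G)) (λ G k → chainCount k G) N)
             (∑-cong (upTo (suc d)) (λ {k} _ → cong (ℤ._*_ (+ (N C k))) (≡.sym (chainCount-suc FF k))))) ⟩
      binomialSum d (λ k → chainCount k F) N ℤ.+ binomialSum d (λ k → chainCount (suc k) F) N
        ≡⟨ binomialSum-suc d (λ k → chainCount k F) N (no-longer FF) ⟨
      binomialSum d (λ k → chainCount k F) (suc N) ∎
      where open ≡-Reasoning

    totalCount-binomial : ∀ N → totalCount N ⊤ ≡ binomialSum d (λ k → + length (canonicalChains k)) N
    totalCount-binomial N = begin
      ∑ 𝓕 (interiorCount N)
        ≡⟨ ∑-cong 𝓕 (λ {F} F∈ → ≡.trans (interiorCount-binomial N (𝓕⁻ F∈))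
             (≡.sym (ℤ.*-identityˡ (binomialSum d (λ k → chainCount k F) N)))) ⟩
      ∑ 𝓕 (λ F → + 1 ℤ.* binomialSum d (λ k → chainCount k F) N)
        ≡⟨ ∑-binomialSum d (λ _ → + 1) (λ F k → chainCount k F) N ⟩
      binomialSum d (λ k → ∑ 𝓕 (λ F → + 1 ℤ.* chainCount k F)) N
        ≡⟨ ∑-cong (upTo (suc d)) (λ {k} _ → cong (ℤ._*_ (+ (N C k))) (≡.trans
             (∑-cong 𝓕 (λ {F} _ → ℤ.*-identityˡ (chainCount k F))) (≡.sym (length≡∑chainCount k)))) ⟩
      binomialSum d (λ k → + length (canonicalChains k)) N ∎
      where open ≡-Reasoning

  -- The apexes of such a chain would be d + 2 affinely independent points of a d-polytope.
  chainCount-vanishes : ∀ {d} → ¬ (∃[ q ] AffinelyIndependent {e} {suc (suc d)} q × (∀ i → q i U.∈ conv p)) →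
                        ∀ F → chainCount (suc d) F ≡ + 0
  chainCount-vanishes {d} no-simplex F = ∑-zero (vecs 𝓕 (suc d)) λ {v} _ → 𝟙-no (canonical? (F ∷ v)) λ chain →
    no-simplex (apexes (F ∷ v) , canonical-independent (F ∷ v) chain , λ i → ∈-hull p ∈⊤)

  number-zero : ∀ b S point? → number p V b S point? 0 ≡ + 0
  number-zero zero    S _       = ≡.refl
  number-zero (suc b) S (yes _) = ≡.refl
  number-zero (suc b) S (no _)  = ≡.refl

-- Polytope numbers from the pointed triangulation

conv-nonempty : ∀ {κ ℓ₁ ℓ₂} (K : OrderedField κ ℓ₁ ℓ₂) → let open Polytopes K in
                ∀ {e m} {p : Fin m → Point e} {x} → x U.∈ conv p → Nonempty {m} ⊤
conv-nonempty K {m = zero}  (_ , _ , _ , 0≈1 , _) = contradiction 0≈1 (OrderedField.0≉1 K)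
conv-nonempty K {m = suc m} _                     = zero , ∈⊤

open import Data.Integer using (_*_; _-_)
open import Data.Nat using (_≤_)
open import Relation.Unary using (_∩_)

theorem4p5 : ∀ {c ℓ₁ ℓ₂} (K : OrderedField c ℓ₁ ℓ₂) → let open Polytopes K in
    ∀ {e m d : ℕ} (p : Fin m → Point e) → HasDimension (conv p) d →
    (c : Point e) → Separates c (conv p) →
    (V : ApexSystem p c) →
    (dₖ : ℕ → ℕ) → (∀ k → k ≤ d → HasSize (Triangulation p V d ∩ IsSimplex k) (dₖ k)) →
    ∀ n → n ≢ 1 →
    polytopeNumber p V n ≡ ∑ (upTo (suc d)) (λ k → + dₖ k * + α k (+ n - + suc k))
-- For n = 0 every argument of `α` is negative, so each value computes to 0.
theorem4p5 K {m = m} {d} p _ c separates V dₖ sizes 0 _ = ≡.trans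
  (number-zero ∣ ⊤ {m} ∣ ⊤ (Polytopes.isPoint? K p ⊤))
  (≡.sym (∑-zero (upTo (suc d)) (λ {k} _ → ℤ.*-zeroʳ (+ dₖ k))))
  where open Simplexes K p separates V
-- The formula fails at n = 1: the arguments -k are at most 0, so the sum is 0, while P(1) = 1.
theorem4p5 K p _ c separates V dₖ sizes 1 n≢1 = contradiction ≡.refl n≢1
theorem4p5 K {m = m} {d} p ((q , _ , q∈) , no-simplex) c separates V dₖ sizes (suc (suc N)) _ = begin
  Polytopes.polytopeNumber K p V (suc (suc N))
    ≡⟨ number≡totalCount ∣ ⊤ {m} ∣ (face-⊤ (conv-nonempty K (q∈ zero))) ℕ.≤-refl (Polytopes.isPoint? K p ⊤) N ⟩
  totalCount N ⊤
    ≡⟨ totalCount-binomial (λ {F} _ → chainCount-vanishes no-simplex F) N ⟩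
  binomialSum d (λ k → + length (canonicalChains k)) N
    ≡⟨ ∑-cong (upTo (suc d)) (λ {k} k∈ → term k (ℕ.≤-pred (∈-upTo⁻ k∈))) ⟩
  ∑ (upTo (suc d)) (λ k → + dₖ k * + α k (+ suc (suc N) - + suc k)) ∎
  where
  open ≡-Reasoning
  open Faces K p using (face-⊤)
  open Chains K p separates V using (totalCount; number≡totalCount)
  open Simplexes K p separates V
  term : ∀ k → k ≤ d → + (N C k) * + length (canonicalChains k) ≡ + dₖ k * + α k (+ suc (suc N) - + suc k)
  term k k≤d = ≡.trans (ℤ.*-comm (+ (N C k)) (+ length (canonicalChains k)))
    (cong₂ (λ x y → + x * + y) (≡.sym (size≡length k≤d (sizes k k≤d))) (≡.sym (α-binomial k N)))
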